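{- A stable noncommutative polynomial $P\in\mathbb{C}\langle A\rangle$ satisfies, for every $n\ge2$ and every $1\le i<n$, \[ P_n(a_1,\dots,a_n)\big|_{a_{i+1}=a_i}=P_{n-2}(a_1,\dots,a_{i-1},a_{i+2},\dots,a_n) \] if and only if $P$ belongs to $\mathbf{WQSym}(\mathbb{A})=\{F(\mathbb{A}):F\in\mathbf{WQSym}\}$.
   Context: $A=\{a_1,a_2,\dots\}$ noncommuting variables; a stable noncommutative polynomial is $P=(P_n)_{n\ge0}$, $P_n\in\mathbb{C}\langle a_1,\dots,a_n\rangle$, of bounded degree, with $P_{n+1}(a_1,\dots,a_n,0)=P_n$; they form $\mathbb{C}\langle A\rangle$. For a word $w$ over $\mathbb{Z}_{>0}$, $\mathbf{a}_w=a_{w_1}\cdots a_{w_k}$. A word $u$ is packed if whenever letter $j+1$ occurs, $j$ occurs; $\mathrm{pack}(w)$ replaces the smallest letter of $w$ by $1$, the second smallest by $2$, etc. $\mathbf{WQSym}$ is the span of $P_u=\sum_{\mathrm{pack}(w)=u}\mathbf{a}_w$ over packed words $u$. The evaluation on the virtual alphabet $\mathbb{A}=\ominus(a_1)\oplus(a_2)\ominus(a_3)\cdots$ is the linear map $F\mapsto F(\mathbb{A})$ given, for a packed word $u=u_1\cdots u_n$ with largest letter $r$, by: $P_u(\mathbb{A})$ is the stable noncommutative polynomial whose $N$-th component is \[ \sum_g\ \prod_{j\ \mathrm{odd}}(-1)^{|g^{ -1}(j)|}\ a_{g(u_1)}a_{g(u_2)}\cdots a_{g(u_n)}, \] the sum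 over weakly increasing maps $g:\{1,\dots,r\}\to\{1,\dots,N\}$ with $|g^{ -1}(j)|\le1$ for every even $j$. -}

module Defs where

open import Level using (Level; _⊔_)
open import Algebra.Bundles using (CommutativeRing)
open import Data.Nat as ℕ using (ℕ; zero; suc; _≤_; _<_)
open import Data.Nat.Properties using (_≤?_; _<?_)
open import Data.Nat.Divisibility using (_∣_; _∣?_)
open import Relation.Nullary.Decidable using (¬?)
open import Data.Fin as Fin using (Fin; toℕ; inject₁; raise)
open import Data.Fin.Properties using (all?; ≤-decTotalOrder) renaming (_≟_ to _≟F_)
open import Data.List using (List; []; _∷_; map; foldr; concatMap; filter; length; allFin)
open import Data.List.Properties using (≡-dec)
open import Data.List.Membership.Propositional using (_∈_)
open import Data.Vec using (Vec; []; _∷_; lookup)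
open import Data.Product using (Σ; ∃; _×_; _,_)
open import Relation.Nullary using (Dec; yes; no; ¬_)
open import Relation.Binary.PropositionalEquality using (_≡_)

-- A field of characteristic zero (stdlib has no Field bundle).
-- ℂ is an instance; we state the theorem for every such field.

ringFromℕ : ∀ {c ℓ} (R : CommutativeRing c ℓ) → ℕ → CommutativeRing.Carrier R
ringFromℕ R zero    = CommutativeRing.0# R
ringFromℕ R (suc n) = CommutativeRing._+_ R (CommutativeRing.1# R) (ringFromℕ R n)

record CharZeroField (c ℓ : Level) : Set (Level.suc (c ⊔ ℓ)) where
  field
    commRing : CommutativeRing c ℓ
  open CommutativeRing commRing public
  field
    1≉0      : ¬ (1# ≈ 0#)
    inverse  : ∀ x → ¬ (x ≈ 0#) → ∃ λ y → (x * y) ≈ 1#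
    charZero : ∀ n → ¬ (ringFromℕ commRing (suc n) ≈ 0#)

module _ {c ℓ : Level} (K : CharZeroField c ℓ) where
  open CharZeroField K

  Σl : List Carrier → Carrier
  Σl = foldr _+_ 0#

  Πl : List Carrier → Carrier
  Πl = foldr _*_ 1#

  neg1^ : ℕ → Carrier
  neg1^ zero    = 1#
  neg1^ (suc k) = - neg1^ k

  [_] : ∀ {p} {P : Set p} → Dec P → Carrier
  [ yes _ ] = 1#
  [ no  _ ] = 0#

  -- Noncommutative polynomials in the variables a₁,…,aₙ are represented
  -- by their coefficient functions on words over Fin n
  -- (letter k : Fin n stands for the variable a_{k+1}).

  Word : ℕ → Set
  Word n = List (Fin n)

  NCPoly : ℕ → Set c
  NCPoly n = Word n → Carrier

  allWords : (n k : ℕ) → List (Word n)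
  allWords n zero    = [] ∷ []
  allWords n (suc k) = concatMap (λ x → map (x ∷_) (allWords n k)) (allFin n)

  -- Substitution of variables by variables: for f : Fin m → Fin n,
  -- p(a_{f(1)},…,a_{f(m)}) ∈ ℂ⟨a₁,…,aₙ⟩ for p ∈ ℂ⟨a₁,…,a_m⟩.
  -- Coefficient of v is the sum of the coefficients of all words w with f(w) = v.
  substVar : ∀ {m n} → (Fin m → Fin n) → NCPoly m → NCPoly n
  substVar {m} f p v =
    Σl (map (λ w → [ ≡-dec _≟F_ (map f w) v ] * p w) (allWords m (length v)))

  _≈P_ : ∀ {n} → NCPoly n → NCPoly n → Set ℓ
  p ≈P q = ∀ v → p v ≈ q v

  record StablePoly : Set (c ⊔ ℓ) where
    field
      comp    : (n : ℕ) → NCPoly n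
      bounded : ∃ λ d → ∀ n (w : Word n) → d < length w → comp n w ≈ 0#
      -- P_{n+1}(a₁,…,aₙ,0) = Pₙ : coefficients of words avoiding a_{n+1}
      stable  : ∀ n (w : Word n) → comp (suc n) (map inject₁ w) ≈ comp n w

  -- The specialisation a_{i+1} = a_i and the deletion of a_i, a_{i+1}.
  -- Here n = m + 2 and i = toℕ i' + 1 with i' : Fin (m + 1), so 1 ≤ i < n.
  -- Letter indices are 0-based: a_i ↔ inject₁ i', a_{i+1} ↔ Fin.suc i'.

  mergeNext : ∀ {m} → Fin (suc m) → Fin (suc (suc m)) → Fin (suc (suc m))
  mergeNext i' x with toℕ x ℕ.≟ suc (toℕ i')
  ... | yes _ = inject₁ i'
  ... | no  _ = x

  skipTwo : ∀ {m} → Fin (suc m) → Fin m → Fin (suc (suc m))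
  skipTwo i' j with toℕ j <? toℕ i'
  ... | yes _ = inject₁ (inject₁ j)
  ... | no  _ = 2 Fin.↑ʳ j

  -- WQSym and evaluation on the virtual alphabet 𝔸 = ⊖(a₁) ⊕ (a₂) ⊖ (a₃) ⋯
  -- A packed word with largest letter r is encoded as a word over Fin r
  -- in which every letter of Fin r occurs (letter k ↔ k+1).

  PackedWord : Set
  PackedWord = Σ ℕ λ r → Σ (Word r) λ u → ∀ (j : Fin r) → j ∈ u

  allMaps : (r N : ℕ) → List (Vec (Fin N) r)
  allMaps zero    N = [] ∷ []
  allMaps (suc r) N = concatMap (λ x → map (x ∷_) (allMaps r N)) (allFin N)

  fiberSize : ∀ {r N} → Vec (Fin N) r → Fin N → ℕ
  fiberSize {r} g j = length (filter (λ k → lookup g k ≟F j) (allFin r))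

  WeaklyIncreasing : ∀ {r N} → Vec (Fin N) r → Set
  WeaklyIncreasing {r} g = ∀ (k l : Fin r) → toℕ k ≤ toℕ l → toℕ (lookup g k) ≤ toℕ (lookup g l)

  weaklyIncreasing? : ∀ {r N} (g : Vec (Fin N) r) → Dec (WeaklyIncreasing g)
  weaklyIncreasing? g =
    all? (λ k → all? (λ l → Relation.Nullary.Decidable.Core._→-dec_
      (toℕ k ≤? toℕ l) (toℕ (lookup g k) ≤? toℕ (lookup g l))))
    where import Relation.Nullary.Decidable.Core

  -- |g⁻¹(j)| ≤ 1 for every even j (1-based j = toℕ j + 1)
  EvenFibers : ∀ {r N} → Vec (Fin N) r → Set
  EvenFibers g = ∀ j → 2 ∣ suc (toℕ j) → fiberSize g j ≤ 1

  evenFibers? : ∀ {r N} (g : Vec (Fin N) r) → Dec (EvenFibers g)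
  evenFibers? g = all? (λ j → Relation.Nullary.Decidable.Core._→-dec_
      (2 ∣? suc (toℕ j)) (fiberSize g j ≤? 1))
    where import Relation.Nullary.Decidable.Core

  sign : ∀ {r N} → Vec (Fin N) r → Carrier
  sign {r} {N} g =
    Πl (map (λ j → [ ¬? (2 ∣? suc (toℕ j)) ] * neg1^ (fiberSize g j)
                   + [ 2 ∣? suc (toℕ j) ])
            (allFin N))

  evalPu : PackedWord → (N : ℕ) → NCPoly N
  evalPu (r , u , _) N v =
    Σl (map (λ g → [ weaklyIncreasing? g ] * [ evenFibers? g ] * sign g
                   * [ ≡-dec _≟F_ (map (lookup g) u) v ])
            (allMaps r N))

  -- An element F = Σ c_u P_u of WQSym, as a finite linear combination
  -- of the basis P_u (u packed), and its evaluation F(𝔸).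
  WQSymElt : Set c
  WQSymElt = List (Carrier × PackedWord)

  evalWQSym : WQSymElt → (N : ℕ) → NCPoly N
  evalWQSym F N v = Σl (map (λ { (c , u) → c * evalPu u N v }) F)

  InWQSym𝔸 : StablePoly → Set (c ⊔ ℓ)
  InWQSym𝔸 P = ∃ λ (F : WQSymElt) → ∀ N → StablePoly.comp P N ≈P evalWQSym F N

  SpecCondition : StablePoly → Set ℓ
  SpecCondition P = ∀ (m : ℕ) (i' : Fin (suc m)) →
    substVar (mergeNext i') (StablePoly.comp P (suc (suc m)))
      ≈P substVar (skipTwo i') (StablePoly.comp P m)

{-# OPTIONS --safe #-}
module Submission where

-- The coefficient of a map g in P_u(𝔸) is a product over consecutive letters x, y of g of weights
-- that vanish unless x < y or x = y is odd. When aᵢ₊₁ is set to aᵢ, the letters i and i + 1 have opposite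
-- signs and, as states of this chain, the same continuation sums, so they cancel: F(𝔸) has the
-- specialisation property.
--
-- Conversely, a family with that property is determined by its coefficients on words in even letters.
-- Coefficients are unchanged when two adjacent unused letters are inserted. If an odd letter l
-- occurs, make l + 1 unused in this way and specialise a_{l+1} = a_l: the coefficients of the words obtained
-- by changing some occurrences of l into l + 1 sum to 0, and all but the original word have
-- fewer odd letters. On words in even letters P_u(𝔸) agrees with P_u, so P = F(𝔸) for
-- F = Σ c_u P_u, with c_u the coefficient in P of the word obtained from u by doubling all letters.

open import Level using (Level)
import Algebra.Properties.Ring as RingProperties
import Algebra.Properties.CommutativeSemigroup as CommutativeSemigroupProperties
open import Data.Nat as ℕ using (ℕ; zero; suc; _≤_; _<_; z≤n; s≤s)
import Data.Nat.Properties as ℕₚ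
open import Data.Nat.Divisibility using (_∣_; divides; _∣?_; _∣0; ∣m∣n⇒∣m+n; ∣m+n∣m⇒∣n; ∣-refl; ∣1⇒≡1)
open import Data.Nat.ListAction using (sum)
open import Data.Fin as Fin using (Fin; zero; suc; toℕ; fromℕ<; inject₁)
import Data.Fin.Properties as Finₚ
open import Data.List as List using (List; []; _∷_; map; concatMap; filter; length; allFin; tabulate; _++_)
import Data.List.Properties as Listₚ
open import Data.List.Properties using (≡-dec)
open import Data.List.Membership.Propositional using (_∈_; find)
open import Data.List.Membership.Propositional.Properties
  using (∈-map⁺; ∈-map⁻; ∈-lookup; ∈-filter⁺; ∈-filter⁻; ∈-allFin)
import Data.List.Membership.DecPropositional as DecMembership
open import Data.List.Relation.Unary.Any using (here; there; index)
open import Data.List.Relation.Unary.Any.Properties using (lookup-index)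
open import Data.List.Relation.Unary.All as All using (All; []; _∷_)
import Data.List.Relation.Unary.All.Properties as Allₚ
open import Data.List.Relation.Unary.AllPairs using (AllPairs; []; _∷_)
import Data.List.Relation.Unary.AllPairs.Properties as AllPairsₚ
open import Data.Vec as Vec using (Vec; []; _∷_; lookup)
import Data.Vec.Properties as Vecₚ
open import Data.Product using (Σ; ∃; _×_; _,_; proj₁; proj₂)
open import Data.Sum using (_⊎_; inj₁; inj₂)
open import Data.Unit using (⊤; tt)
open import Function using (_∘_; id)
open import Relation.Nullary using (Dec; yes; no; ¬_; contradiction)
open import Relation.Nullary.Decidable using (¬?; _×-dec_; _⊎-dec_)
open import Relation.Binary.PropositionalEquality as ≡ using (_≡_; _≢_; refl; cong; cong₂; subst)
open import Defs

-- Parity of natural numbers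

Even Odd : ℕ → Set
Even n = 2 ∣ n
Odd n = ¬ (2 ∣ n)

even-+2 : ∀ {n} → Even n → Even (2 ℕ.+ n)
even-+2 = ∣m∣n⇒∣m+n ∣-refl

even-+2⁻ : ∀ {n} → Even (2 ℕ.+ n) → Even n
even-+2⁻ e = ∣m+n∣m⇒∣n e ∣-refl

even⊎even-suc : ∀ n → Even n ⊎ Even (suc n)
even⊎even-suc zero = inj₁ (2 ∣0)
even⊎even-suc (suc n) with even⊎even-suc n
... | inj₁ e = inj₂ (even-+2 e)
... | inj₂ e = inj₁ e

odd⇒even-suc : ∀ {n} → Odd n → Even (suc n)
odd⇒even-suc {n} o with even⊎even-suc n
... | inj₁ e = contradiction e o
... | inj₂ e = e

even⇒odd-suc : ∀ {n} → Even n → Odd (suc n)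
even⇒odd-suc {n} e e′ = contradiction (∣1⇒≡1 (∣m+n∣m⇒∣n (subst Even (ℕₚ.+-comm 1 n) e′) e)) λ ()

-- Opening a gap of two letters

-- skipTwo on numbers. It commutes with suc, so it serves for 0-based letters and for the 1-based ones of the paper.
opaque
  skip : ℕ → ℕ → ℕ
  skip i x with x ℕₚ.<? i
  ... | yes _ = x
  ... | no  _ = 2 ℕ.+ x

-- `skip` is opaque and gets evaluated through this view: matching replaces `skip i x` by its value
-- and records on which side of the gap x lies.
data SkipView (i : ℕ) : ℕ → ℕ → Set where
  below : ∀ {x} → x < i → SkipView i x x
  above : ∀ {x} → i ≤ x → SkipView i x (2 ℕ.+ x)

opaque
  unfolding skip

  skipView : ∀ i x → SkipView i x (skip i x)
  skipView i x with x ℕₚ.<? i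
  ... | yes x<i = below x<i
  ... | no  x≮i = above (ℕₚ.≮⇒≥ x≮i)

skip-< : ∀ {i x} → x < i → skip i x ≡ x
skip-< {i} {x} x<i with skip i x | skipView i x
... | _ | below _   = refl
... | _ | above i≤x = contradiction x<i (ℕₚ.≤⇒≯ i≤x)

skip-≥ : ∀ {i x} → i ≤ x → skip i x ≡ 2 ℕ.+ x
skip-≥ {i} {x} i≤x with skip i x | skipView i x
... | _ | below x<i = contradiction x<i (ℕₚ.≤⇒≯ i≤x)
... | _ | above _   = refl

skip-suc : ∀ i x → skip (suc i) (suc x) ≡ suc (skip i x)
skip-suc i x with skip i x | skipView i x
... | _ | below x<i = skip-< (s≤s x<i)
... | _ | above i≤x = skip-≥ (s≤s i≤x)

skip≢ : ∀ i x → skip i x ≢ i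
skip≢ i x eq with skip i x | skipView i x
... | _ | below x<i = ℕₚ.<⇒≢ x<i eq
... | _ | above i≤x = ℕₚ.<⇒≢ (ℕₚ.m≤n⇒m≤1+n (s≤s i≤x)) (≡.sym eq)

skip≢suc : ∀ i x → skip i x ≢ suc i
skip≢suc i x eq with skip i x | skipView i x
... | _ | below x<i = ℕₚ.<⇒≢ (ℕₚ.m≤n⇒m≤1+n x<i) eq
... | _ | above i≤x = ℕₚ.<⇒≢ (s≤s (s≤s i≤x)) (≡.sym eq)

skip-cancel-< : ∀ i {x y} → skip i x < skip i y → x < y
skip-cancel-< i {x} {y} p with skip i x | skipView i x | skip i y | skipView i y
... | _ | below _   | _ | below _   = p
... | _ | below x<i | _ | above i≤y = ℕₚ.<-≤-trans x<i i≤y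
... | _ | above i≤x | _ | below y<i =
  contradiction (ℕₚ.<-trans p y<i) (ℕₚ.≤⇒≯ (ℕₚ.m≤n⇒m≤1+n (ℕₚ.m≤n⇒m≤1+n i≤x)))
... | _ | above _   | _ | above _   = ℕₚ.+-cancelˡ-< 2 x y p

skip-mono-< : ∀ i {x y} → x < y → skip i x < skip i y
skip-mono-< i {x} {y} p with skip i x | skipView i x | skip i y | skipView i y
... | _ | below _   | _ | below _   = p
... | _ | below _   | _ | above _   = ℕₚ.m≤n⇒m≤1+n (ℕₚ.m≤n⇒m≤1+n p)
... | _ | above i≤x | _ | below y<i = contradiction (ℕₚ.<-trans p y<i) (ℕₚ.≤⇒≯ i≤x)
... | _ | above _   | _ | above _   = ℕₚ.+-monoʳ-< 2 p

skip-injective : ∀ i {x y} → skip i x ≡ skip i y → x ≡ y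
skip-injective i {x} {y} eq = ℕₚ.≤-antisym
  (ℕₚ.≮⇒≥ λ y<x → ℕₚ.<⇒≢ (skip-mono-< i y<x) (≡.sym eq))
  (ℕₚ.≮⇒≥ λ x<y → ℕₚ.<⇒≢ (skip-mono-< i x<y) eq)

skip-even : ∀ i {x} → Even x → Even (skip i x)
skip-even i {x} e with skip i x | skipView i x
... | _ | below _ = e
... | _ | above _ = even-+2 e

skip-even⁻ : ∀ i {x} → Even (skip i x) → Even x
skip-even⁻ i {x} e with skip i x | skipView i x
... | _ | below _ = e
... | _ | above _ = even-+2⁻ e

map-toℕ-injective : ∀ {n} {v w : List (Fin n)} → map toℕ v ≡ map toℕ w → v ≡ w
map-toℕ-injective = Listₚ.map-injective Finₚ.toℕ-injective

module _ {c ℓ : Level} (K : CharZeroField c ℓ) where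
  open CharZeroField K hiding (zero) renaming (refl to ≈-refl; sym to ≈-sym; trans to ≈-trans)
  open RingProperties ring using (-1*x≈-x)
  module +S = CommutativeSemigroupProperties +-commutativeSemigroup
  module *S = CommutativeSemigroupProperties *-commutativeSemigroup
  open import Relation.Binary.Reasoning.Setoid setoid

  -- Indicators of decidable propositions

  ⟦_⟧ : ∀ {p} {P : Set p} → Dec P → Carrier
  ⟦ d ⟧ = [_] K d

  ⟦⟧-yes : ∀ {p} {P : Set p} (d : Dec P) → P → ⟦ d ⟧ ≈ 1#
  ⟦⟧-yes (yes _) _ = ≈-refl
  ⟦⟧-yes (no ¬p) p = contradiction p ¬p

  ⟦⟧-no : ∀ {p} {P : Set p} (d : Dec P) → ¬ P → ⟦ d ⟧ ≈ 0#
  ⟦⟧-no (yes p) ¬p = contradiction p ¬p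
  ⟦⟧-no (no _)  _  = ≈-refl

  ⟦⟧-cong : ∀ {p q} {P : Set p} {Q : Set q} (d : Dec P) (e : Dec Q) →
            (P → Q) → (Q → P) → ⟦ d ⟧ ≈ ⟦ e ⟧
  ⟦⟧-cong (yes p) e f g = ≈-sym (⟦⟧-yes e (f p))
  ⟦⟧-cong (no ¬p) e f g = ≈-sym (⟦⟧-no e (¬p ∘ g))

  yes-* : ∀ {p} {P : Set p} (d : Dec P) {x} → P → ⟦ d ⟧ * x ≈ x
  yes-* d p = ≈-trans (*-congʳ (⟦⟧-yes d p)) (*-identityˡ _)

  no-* : ∀ {p} {P : Set p} (d : Dec P) {x} → ¬ P → ⟦ d ⟧ * x ≈ 0#
  no-* d ¬p = ≈-trans (*-congʳ (⟦⟧-no d ¬p)) (zeroˡ _)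

  *-yes : ∀ {p} {P : Set p} (d : Dec P) {x} → P → x * ⟦ d ⟧ ≈ x
  *-yes d p = ≈-trans (*-congˡ (⟦⟧-yes d p)) (*-identityʳ _)

  *-no : ∀ {p} {P : Set p} (d : Dec P) {x} → ¬ P → x * ⟦ d ⟧ ≈ 0#
  *-no d ¬p = ≈-trans (*-congˡ (⟦⟧-no d ¬p)) (zeroʳ _)

  0*-≈ : ∀ {x y} → x ≈ 0# → x * y ≈ 0#
  0*-≈ p = ≈-trans (*-congʳ p) (zeroˡ _)

  *0-≈ : ∀ {x y} → y ≈ 0# → x * y ≈ 0#
  *0-≈ p = ≈-trans (*-congˡ p) (zeroʳ _)

  0+-≈ : ∀ {x y} → x ≈ 0# → x + y ≈ y
  0+-≈ p = ≈-trans (+-congʳ p) (+-identityˡ _)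

  +0-≈ : ∀ {x y} → y ≈ 0# → x + y ≈ x
  +0-≈ p = ≈-trans (+-congˡ p) (+-identityʳ _)

  -- Finite sums

  ∑ : ∀ {a} {A : Set a} → List A → (A → Carrier) → Carrier
  ∑ xs f = Σl K (map f xs)

  module _ {a} {A : Set a} where

    ∑-cong : ∀ (xs : List A) {f g} → (∀ x → f x ≈ g x) → ∑ xs f ≈ ∑ xs g
    ∑-cong []       p = ≈-refl
    ∑-cong (x ∷ xs) p = +-cong (p x) (∑-cong xs p)

    ∑-0 : ∀ (xs : List A) {f} → (∀ x → f x ≈ 0#) → ∑ xs f ≈ 0#
    ∑-0 []       p = ≈-refl
    ∑-0 (x ∷ xs) p = ≈-trans (0+-≈ (p x)) (∑-0 xs p)

    ∑-++ : ∀ (xs ys : List A) f → ∑ (xs ++ ys) f ≈ ∑ xs f + ∑ ys f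
    ∑-++ []       ys f = ≈-sym (+-identityˡ _)
    ∑-++ (x ∷ xs) ys f = ≈-trans (+-congˡ (∑-++ xs ys f)) (≈-sym (+-assoc _ _ _))

    ∑-+ : ∀ (xs : List A) f g → ∑ xs (λ x → f x + g x) ≈ ∑ xs f + ∑ xs g
    ∑-+ []       f g = ≈-sym (+-identityˡ _)
    ∑-+ (x ∷ xs) f g = ≈-trans (+-congˡ (∑-+ xs f g)) (+S.interchange _ _ _ _)

    ∑-*ˡ : ∀ (xs : List A) k f → ∑ xs (λ x → k * f x) ≈ k * ∑ xs f
    ∑-*ˡ []       k f = ≈-sym (zeroʳ _)
    ∑-*ˡ (x ∷ xs) k f = ≈-trans (+-congˡ (∑-*ˡ xs k f)) (≈-sym (distribˡ _ _ _))

    ∑-concatMap : ∀ {b} {B : Set b} (h : B → List A) ys f →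
                  ∑ (concatMap h ys) f ≈ ∑ ys (λ y → ∑ (h y) f)
    ∑-concatMap h []       f = ≈-refl
    ∑-concatMap h (y ∷ ys) f =
      ≈-trans (∑-++ (h y) (concatMap h ys) f) (+-congˡ (∑-concatMap h ys f))

  ∑-swap : ∀ {a b} {A : Set a} {B : Set b} (xs : List A) (ys : List B) (f : A → B → Carrier) →
           ∑ xs (λ x → ∑ ys (f x)) ≈ ∑ ys (λ y → ∑ xs (λ x → f x y))
  ∑-swap []       ys f = ≈-sym (∑-0 ys (λ _ → ≈-refl))
  ∑-swap (x ∷ xs) ys f = begin
    ∑ ys (f x) + ∑ xs (λ x → ∑ ys (f x))            ≈⟨ +-congˡ (∑-swap xs ys f) ⟩
    ∑ ys (f x) + ∑ ys (λ y → ∑ xs (λ x → f x y))    ≈⟨ ∑-+ ys (f x) _ ⟨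
    ∑ ys (λ y → f x y + ∑ xs (λ x → f x y))         ∎

  ∑-allFin-suc : ∀ n (f : Fin (suc n) → Carrier) →
                 ∑ (allFin (suc n)) f ≡ f zero + ∑ (allFin n) (f ∘ suc)
  ∑-allFin-suc n f = cong (λ l → f zero + Σl K l)
    (≡.trans (Listₚ.map-tabulate suc f) (≡.sym (Listₚ.map-tabulate id (f ∘ suc))))

  ∑-allFin-single : ∀ {n} (x₀ : Fin n) f → (∀ x → x ≢ x₀ → f x ≈ 0#) → ∑ (allFin n) f ≈ f x₀
  ∑-allFin-single {suc n} zero f p = begin
    ∑ (allFin (suc n)) f              ≡⟨ ∑-allFin-suc n f ⟩
    f zero + ∑ (allFin n) (f ∘ suc)   ≈⟨ +0-≈ (∑-0 (allFin n) (λ x → p (suc x) λ ())) ⟩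
    f zero                            ∎
  ∑-allFin-single {suc n} (suc x₀) f p = begin
    ∑ (allFin (suc n)) f              ≡⟨ ∑-allFin-suc n f ⟩
    f zero + ∑ (allFin n) (f ∘ suc)   ≈⟨ 0+-≈ (p zero λ ()) ⟩
    ∑ (allFin n) (f ∘ suc)            ≈⟨ ∑-allFin-single x₀ (f ∘ suc) (λ x x≢ → p (suc x) (x≢ ∘ Finₚ.suc-injective)) ⟩
    f (suc x₀)                        ∎

  ∑-allWords-suc : ∀ n k f → ∑ (allWords K n (suc k)) f ≈
                   ∑ (allFin n) (λ x → ∑ (allWords K n k) (f ∘ (x ∷_)))
  ∑-allWords-suc n k f = ≈-trans
    (∑-concatMap (λ x → map (x ∷_) (allWords K n k)) (allFin n) f)
    (∑-cong (allFin n) λ x → reflexive (cong (Σl K) (≡.sym (Listₚ.map-∘ (allWords K n k)))))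

  ∑-allMaps-suc : ∀ r N f → ∑ (allMaps K (suc r) N) f ≈
                  ∑ (allFin N) (λ x → ∑ (allMaps K r N) (f ∘ (x ∷_)))
  ∑-allMaps-suc r N f = ≈-trans
    (∑-concatMap (λ x → map (x ∷_) (allMaps K r N)) (allFin N) f)
    (∑-cong (allFin N) λ x → reflexive (cong (Σl K) (≡.sym (Listₚ.map-∘ (allMaps K r N)))))

  ∑-allWords-0 : ∀ n k f → (∀ w → length w ≡ k → f w ≈ 0#) → ∑ (allWords K n k) f ≈ 0#
  ∑-allWords-0 n zero    f p = ≈-trans (+-identityʳ _) (p [] refl)
  ∑-allWords-0 n (suc k) f p = ≈-trans (∑-allWords-suc n k f)
    (∑-0 (allFin n) λ x → ∑-allWords-0 n k (f ∘ (x ∷_)) (λ w eq → p (x ∷ w) (cong suc eq)))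

  ∑-allWords-single : ∀ {n k} (w₀ : List (Fin n)) f → length w₀ ≡ k →
                      (∀ w → w ≢ w₀ → f w ≈ 0#) → ∑ (allWords K n k) f ≈ f w₀
  ∑-allWords-single []       f refl p = +-identityʳ _
  ∑-allWords-single {n} (x₀ ∷ w₀) f refl p = begin
    ∑ (allWords K n (suc (length w₀))) f
      ≈⟨ ∑-allWords-suc n (length w₀) f ⟩
    ∑ (allFin n) (λ x → ∑ (allWords K n (length w₀)) (f ∘ (x ∷_)))
      ≈⟨ ∑-allFin-single x₀ _ (λ x x≢ → ∑-0 (allWords K n (length w₀)) (λ w → p (x ∷ w) (x≢ ∘ Listₚ.∷-injectiveˡ))) ⟩
    ∑ (allWords K n (length w₀)) (f ∘ (x₀ ∷_))
      ≈⟨ ∑-allWords-single w₀ (f ∘ (x₀ ∷_)) refl (λ w w≢ → p (x₀ ∷ w) (w≢ ∘ Listₚ.∷-injectiveʳ)) ⟩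
    f (x₀ ∷ w₀) ∎

  ∑-allMaps-single : ∀ {r N} (g₀ : Vec (Fin N) r) f → (∀ g → g ≢ g₀ → f g ≈ 0#) →
                     ∑ (allMaps K r N) f ≈ f g₀
  ∑-allMaps-single [] f p = +-identityʳ _
  ∑-allMaps-single {suc r} {N} (x₀ ∷ g₀) f p = begin
    ∑ (allMaps K (suc r) N) f
      ≈⟨ ∑-allMaps-suc r N f ⟩
    ∑ (allFin N) (λ x → ∑ (allMaps K r N) (f ∘ (x ∷_)))
      ≈⟨ ∑-allFin-single x₀ _ (λ x x≢ → ∑-0 (allMaps K r N) (λ g → p (x ∷ g) (x≢ ∘ Vecₚ.∷-injectiveˡ))) ⟩
    ∑ (allMaps K r N) (f ∘ (x₀ ∷_))
      ≈⟨ ∑-allMaps-single g₀ (f ∘ (x₀ ∷_)) (λ g g≢ → p (x₀ ∷ g) (g≢ ∘ Vecₚ.∷-injectiveʳ)) ⟩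
    f (x₀ ∷ g₀) ∎

  -- Merging and skipping letters

  toℕ-skipTwo : ∀ {m} (i : Fin (suc m)) j → toℕ (skipTwo K i j) ≡ skip (toℕ i) (toℕ j)
  toℕ-skipTwo i j with toℕ j ℕₚ.<? toℕ i
  ... | yes j<i = ≡.trans (≡.trans (Finₚ.toℕ-inject₁ _) (Finₚ.toℕ-inject₁ j)) (≡.sym (skip-< j<i))
  ... | no  j≮i = ≡.trans (Finₚ.toℕ-↑ʳ 2 j) (≡.sym (skip-≥ (ℕₚ.≮⇒≥ j≮i)))

  skipTwo-injective : ∀ {m} (i : Fin (suc m)) {j k} → skipTwo K i j ≡ skipTwo K i k → j ≡ k
  skipTwo-injective i {j} {k} eq = Finₚ.toℕ-injective (skip-injective (toℕ i)
    (≡.trans (≡.sym (toℕ-skipTwo i j)) (≡.trans (cong toℕ eq) (toℕ-skipTwo i k))))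

  skipTwo≢inject₁ : ∀ {m} (i : Fin (suc m)) j → skipTwo K i j ≢ inject₁ i
  skipTwo≢inject₁ i j eq = skip≢ (toℕ i) (toℕ j)
    (≡.trans (≡.sym (toℕ-skipTwo i j)) (≡.trans (cong toℕ eq) (Finₚ.toℕ-inject₁ i)))

  skipTwo≢suc : ∀ {m} (i : Fin (suc m)) j → skipTwo K i j ≢ suc i
  skipTwo≢suc i j eq = skip≢suc (toℕ i) (toℕ j)
    (≡.trans (≡.sym (toℕ-skipTwo i j)) (cong toℕ eq))

  mergeNext-suc : ∀ {m} (i : Fin (suc m)) → mergeNext K i (suc i) ≡ inject₁ i
  mergeNext-suc i with toℕ (Fin.suc i) ℕ.≟ suc (toℕ i)
  ... | yes _ = refl
  ... | no ≢i = contradiction refl ≢i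

  mergeNext-≢ : ∀ {m} (i : Fin (suc m)) x → x ≢ suc i → mergeNext K i x ≡ x
  mergeNext-≢ i x x≢ with toℕ x ℕ.≟ suc (toℕ i)
  ... | yes eq = contradiction (Finₚ.toℕ-injective eq) x≢
  ... | no _   = refl

  mergeNext-inject₁ : ∀ {m} (i : Fin (suc m)) → mergeNext K i (inject₁ i) ≡ inject₁ i
  mergeNext-inject₁ i = mergeNext-≢ i (inject₁ i)
    (λ eq → ℕₚ.<⇒≢ ℕₚ.≤-refl (≡.trans (≡.sym (Finₚ.toℕ-inject₁ i)) (cong toℕ eq)))

  mergeNext-skipTwo : ∀ {m} (i : Fin (suc m)) j → mergeNext K i (skipTwo K i j) ≡ skipTwo K i j
  mergeNext-skipTwo i j = mergeNext-≢ i _ (skipTwo≢suc i j)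

  -- Merging moves only the letter `suc i`, and its image `inject₁ i` is not a value of
  -- `skipTwo K i`.
  mergeNext-skipTwo⁻ : ∀ {m} (i : Fin (suc m)) x j →
                       mergeNext K i x ≡ skipTwo K i j → x ≡ skipTwo K i j
  mergeNext-skipTwo⁻ i x j eq with x Finₚ.≟ suc i
  ... | yes refl = contradiction (≡.trans (≡.sym eq) (mergeNext-suc i)) (skipTwo≢inject₁ i j)
  ... | no x≢    = ≡.trans (≡.sym (mergeNext-≢ i x x≢)) eq

  -- `skipTwo K i` misses exactly the two letters that the specialisation identifies. Isolating them
  -- lets their contributions be compared.
  ∑-allFin-skipTwo : ∀ {m} (i : Fin (suc m)) (f : Fin (suc (suc m)) → Carrier) →
    ∑ (allFin (suc (suc m))) f ≈ (f (inject₁ i) + f (suc i)) + ∑ (allFin m) (f ∘ skipTwo K i)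
  ∑-allFin-skipTwo {m} zero f = begin
    ∑ (allFin (suc (suc m))) f
      ≡⟨ ∑-allFin-suc (suc m) f ⟩
    f zero + ∑ (allFin (suc m)) (f ∘ suc)
      ≡⟨ cong (f zero +_) (∑-allFin-suc m (f ∘ suc)) ⟩
    f zero + (f (suc zero) + ∑ (allFin m) (λ j → f (suc (suc j))))
      ≈⟨ +-assoc _ _ _ ⟨
    (f zero + f (suc zero)) + ∑ (allFin m) (λ j → f (suc (suc j)))
      ≈⟨ +-congˡ (∑-cong (allFin m) λ j → reflexive (cong f (Finₚ.toℕ-injective (≡.sym (≡.trans (toℕ-skipTwo zero j) (skip-≥ z≤n)))))) ⟩
    (f zero + f (suc zero)) + ∑ (allFin m) (f ∘ skipTwo K zero) ∎
  ∑-allFin-skipTwo {suc m} (suc i) f = begin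
    ∑ (allFin (suc (suc (suc m)))) f
      ≡⟨ ∑-allFin-suc (suc (suc m)) f ⟩
    f zero + ∑ (allFin (suc (suc m))) (f ∘ suc)
      ≈⟨ +-congˡ (∑-allFin-skipTwo i (f ∘ suc)) ⟩
    f zero + ((f (suc (inject₁ i)) + f (suc (suc i))) + ∑ (allFin m) (λ j → f (suc (skipTwo K i j))))
      ≈⟨ +S.x∙yz≈y∙xz _ _ _ ⟩
    (f (suc (inject₁ i)) + f (suc (suc i))) + (f zero + ∑ (allFin m) (λ j → f (suc (skipTwo K i j))))
      ≈⟨ +-congˡ (+-congˡ (∑-cong (allFin m) λ j → reflexive (cong f (Finₚ.toℕ-injective (≡.sym
          (≡.trans (toℕ-skipTwo (suc i) (suc j)) (≡.trans (skip-suc (toℕ i) (toℕ j)) (cong suc (≡.sym (toℕ-skipTwo i j)))))))))) ⟩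
    (f (suc (inject₁ i)) + f (suc (suc i))) + (f zero + ∑ (allFin m) (λ j → f (skipTwo K (suc i) (suc j))))
      ≈⟨ +-congˡ (reflexive (∑-allFin-suc m (f ∘ skipTwo K (suc i)))) ⟨
    (f (suc (inject₁ i)) + f (suc (suc i))) + ∑ (allFin (suc m)) (f ∘ skipTwo K (suc i)) ∎

  -- Signs and weights of single steps

  -- In weights and chains letters are numbered from 1, so that 0 can serve as the letter before the first one.

  opaque
    sgn : ℕ → Carrier
    sgn y with 2 ∣? y
    ... | yes _ = 1#
    ... | no  _ = - 1#

    sgn-even : ∀ {y} → Even y → sgn y ≈ 1#
    sgn-even {y} e with 2 ∣? y
    ... | yes _ = ≈-refl
    ... | no  o = contradiction e o

    sgn-odd : ∀ {y} → Odd y → sgn y ≈ - 1#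
    sgn-odd {y} o with 2 ∣? y
    ... | yes e = contradiction e o
    ... | no  _ = ≈-refl

  sgn-cancel : ∀ y → sgn y + sgn (suc y) ≈ 0#
  sgn-cancel y with even⊎even-suc y
  ... | inj₁ e = ≈-trans (+-cong (sgn-even e) (sgn-odd (even⇒odd-suc e))) (-‿inverseʳ 1#)
  ... | inj₂ e = ≈-trans (+-cong (sgn-odd (λ e′ → even⇒odd-suc e′ e)) (sgn-even e)) (-‿inverseˡ 1#)

  sgn-skip : ∀ i y → sgn (skip i y) ≈ sgn y
  sgn-skip i y with 2 ∣? y
  ... | yes e = ≈-trans (sgn-even (skip-even i e)) (≈-sym (sgn-even e))
  ... | no  o = ≈-trans (sgn-odd (o ∘ skip-even⁻ i)) (≈-sym (sgn-odd o))

  _⊴_ : ℕ → ℕ → Set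
  x ⊴ y = x < y ⊎ (x ≡ y × Odd y)

  _⊴?_ : ∀ x y → Dec (x ⊴ y)
  x ⊴? y = (x ℕₚ.<? y) ⊎-dec ((x ℕₚ.≟ y) ×-dec ¬? (2 ∣? y))

  ⊴⇒≤ : ∀ {x y} → x ⊴ y → x ≤ y
  ⊴⇒≤ (inj₁ x<y)        = ℕₚ.<⇒≤ x<y
  ⊴⇒≤ (inj₂ (refl , _)) = ℕₚ.≤-refl

  skip-⊴ : ∀ i {x y} → x ⊴ y → skip i x ⊴ skip i y
  skip-⊴ i (inj₁ x<y)        = inj₁ (skip-mono-< i x<y)
  skip-⊴ i (inj₂ (refl , o)) = inj₂ (refl , o ∘ skip-even⁻ i)

  skip-⊴⁻ : ∀ i {x y} → skip i x ⊴ skip i y → x ⊴ y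
  skip-⊴⁻ i (inj₁ p)        = inj₁ (skip-cancel-< i p)
  skip-⊴⁻ i (inj₂ (eq , o)) = inj₂ (skip-injective i eq , o ∘ skip-even i)

  opaque
    weight : ℕ → ℕ → Carrier
    weight x y = ⟦ x ⊴? y ⟧ * sgn y

    weight-⊴ : ∀ {x y} → x ⊴ y → weight x y ≈ sgn y
    weight-⊴ {x} {y} = yes-* (x ⊴? y)

    weight-⋬ : ∀ {x y} → ¬ (x ⊴ y) → weight x y ≈ 0#
    weight-⋬ {x} {y} = no-* (x ⊴? y)

    weight-cong : ∀ {x y x′ y′} → (x ⊴ y → x′ ⊴ y′) → (x′ ⊴ y′ → x ⊴ y) →
                  sgn y ≈ sgn y′ → weight x y ≈ weight x′ y′
    weight-cong {x} {y} {x′} {y′} f g = *-cong (⟦⟧-cong (x ⊴? y) (x′ ⊴? y′) f g)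

  weight-> : ∀ {x y} → y < x → weight x y ≈ 0#
  weight-> y<x = weight-⋬ (λ p → ℕₚ.<⇒≱ y<x (⊴⇒≤ p))

  weight-even-self : ∀ {x} → Even x → weight x x ≈ 0#
  weight-even-self e = weight-⋬ λ { (inj₁ x<x) → ℕₚ.<-irrefl refl x<x ; (inj₂ (_ , o)) → o e }

  weight-skip : ∀ i x y → weight (skip i x) (skip i y) ≈ weight x y
  weight-skip i x y = weight-cong (skip-⊴⁻ i) (skip-⊴ i) (sgn-skip i y)

  -- From a letter below the pair i, i + 1 both steps into it are permitted, with opposite signs;
  -- from a letter above it neither is.
  weight-cancel : ∀ i x → weight (skip i x) i + weight (skip i x) (suc i) ≈ 0#
  weight-cancel i x with skip i x | skipView i x
  ... | _ | below x<i = ≈-trans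
    (+-cong (weight-⊴ (inj₁ x<i)) (weight-⊴ (inj₁ (ℕₚ.m≤n⇒m≤1+n x<i))))
    (sgn-cancel i)
  ... | _ | above i≤x = ≈-trans
    (+-cong (weight-> (ℕₚ.m≤n⇒m≤1+n (s≤s i≤x))) (weight-> (s≤s (s≤s i≤x))))
    (+-identityˡ 0#)

  weight-merge : ∀ i → weight i i + weight i (suc i) ≈ weight (suc i) (suc i)
  weight-merge i with even⊎even-suc i
  ... | inj₁ e = begin
    weight i i + weight i (suc i) ≈⟨ 0+-≈ (weight-even-self e) ⟩
    weight i (suc i)              ≈⟨ weight-⊴ (inj₁ ℕₚ.≤-refl) ⟩
    sgn (suc i)                   ≈⟨ weight-⊴ (inj₂ (refl , even⇒odd-suc e)) ⟨
    weight (suc i) (suc i)        ∎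
  ... | inj₂ e = begin
    weight i i + weight i (suc i)
      ≈⟨ +-cong (weight-⊴ (inj₂ (refl , λ e′ → even⇒odd-suc e′ e))) (weight-⊴ (inj₁ ℕₚ.≤-refl)) ⟩
    sgn i + sgn (suc i)
      ≈⟨ sgn-cancel i ⟩
    0#
      ≈⟨ weight-even-self e ⟨
    weight (suc i) (suc i) ∎

  -- A letter outside the pair lies below both members or above both, and only this comparison
  -- enters the weight.
  weight-suc-skip : ∀ i y → weight i (skip i y) ≈ weight (suc i) (skip i y)
  weight-suc-skip i y with skip i y | skipView i y
  ... | _ | below y<i = ≈-trans (weight-> y<i) (≈-sym (weight-> (ℕₚ.m≤n⇒m≤1+n y<i)))
  ... | _ | above i≤y = weight-cong
    (λ _ → inj₁ (s≤s (s≤s i≤y))) (λ _ → inj₁ (s≤s (ℕₚ.m≤n⇒m≤1+n i≤y))) ≈-refl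

  -- Chain sums and their recursion

  chain : ∀ {r N} → ℕ → Vec (Fin N) r → Carrier
  chain x []      = 1#
  chain x (y ∷ g) = weight x (suc (toℕ y)) * chain (suc (toℕ y)) g

  -- The test function φ is arbitrary so that, after the first letter y is chosen, what remains is
  -- again a chain sum, now with `φ ∘ (y ∷_)`. For P_u(𝔸) it will be the indicator that a map sends
  -- u to a given word.
  chainSum : ∀ {r N} → ℕ → (Vec (Fin N) r → Carrier) → Carrier
  chainSum {r} {N} x φ = ∑ (allMaps K r N) (λ g → chain x g * φ g)

  chainSum-suc : ∀ {r N} x (φ : Vec (Fin N) (suc r) → Carrier) →
    chainSum x φ ≈ ∑ (allFin N) (λ y → weight x (suc (toℕ y)) * chainSum (suc (toℕ y)) (φ ∘ (y ∷_)))
  chainSum-suc {r} {N} x φ = ≈-trans (∑-allMaps-suc r N _) (∑-cong (allFin N) λ y → ≈-trans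
    (∑-cong (allMaps K r N) (λ g → *-assoc _ _ _))
    (∑-*ˡ (allMaps K r N) (weight x (suc (toℕ y))) _))

  -- Cancellation of the two merged letters in a chain sum

  module _ {m} (i : Fin (suc m)) where
    private
      i¹ : ℕ
      i¹ = suc (toℕ i)
      merge : ∀ {r} → Vec (Fin (suc (suc m))) r → Vec (Fin (suc (suc m))) r
      merge = Vec.map (mergeNext K i)
      gap : ∀ {r} → Vec (Fin m) r → Vec (Fin (suc (suc m))) r
      gap = Vec.map (skipTwo K i)

    -- The weights still see the original letters; only the test function sees the merged ones.
    mergedSum : ∀ {r} → ℕ → (Vec (Fin (suc (suc m))) r → Carrier) → Carrier
    mergedSum x φ = chainSum x (φ ∘ merge)

    -- Both letters of the pair reach the test function as `inject₁ i`, so they share `φᵢ` and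
    -- differ only in their weight and in the state that they leave behind.
    mergedSum-suc : ∀ {r} x (φ : Vec (Fin (suc (suc m))) (suc r) → Carrier) →
      let φᵢ = φ ∘ (inject₁ i ∷_) in
      mergedSum x φ ≈
        (weight x i¹ * mergedSum i¹ φᵢ + weight x (suc i¹) * mergedSum (suc i¹) φᵢ)
        + ∑ (allFin m) (λ j → weight x (skip i¹ (suc (toℕ j))) *
                              mergedSum (skip i¹ (suc (toℕ j))) (φ ∘ (skipTwo K i j ∷_)))
    mergedSum-suc {r} x φ = begin
      mergedSum x φ
        ≈⟨ chainSum-suc x (φ ∘ merge) ⟩
      ∑ (allFin (suc (suc m))) term
        ≈⟨ ∑-allFin-skipTwo i term ⟩
      (term (inject₁ i) + term (suc i)) + ∑ (allFin m) (term ∘ skipTwo K i)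
        ≈⟨ +-cong (+-cong
             (reflexive (cong₂ step (cong suc (Finₚ.toℕ-inject₁ i)) (mergeNext-inject₁ i)))
             (reflexive (cong₂ step refl (mergeNext-suc i))))
             (∑-cong (allFin m) λ j → reflexive (cong₂ step
               (≡.trans (cong suc (toℕ-skipTwo i j)) (≡.sym (skip-suc (toℕ i) (toℕ j))))
               (mergeNext-skipTwo i j))) ⟩
      (step i¹ (inject₁ i) + step (suc i¹) (inject₁ i))
        + ∑ (allFin m) (λ j → step (skip i¹ (suc (toℕ j))) (skipTwo K i j)) ∎
      where
      step : ℕ → Fin (suc (suc m)) → Carrier
      step y z = weight x y * mergedSum y (φ ∘ (z ∷_))
      term : Fin (suc (suc m)) → Carrier
      term y = step (suc (toℕ y)) (mergeNext K i y)

    -- Induction on the length. By the induction hypothesis the continuations after a step within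
    -- the pair agree, so only total weights matter there, and `weight-merge` equates these. Steps
    -- leaving the pair agree by `weight-suc-skip`.
    mergedSum-state : ∀ {r} (φ : Vec (Fin (suc (suc m))) r → Carrier) →
                      mergedSum i¹ φ ≈ mergedSum (suc i¹) φ
    mergedSum-state {zero}  φ = ≈-refl
    mergedSum-state {suc r} φ = begin
      mergedSum i¹ φ
        ≈⟨ mergedSum-suc i¹ φ ⟩
      (weight i¹ i¹ * mergedSum i¹ φᵢ + weight i¹ (suc i¹) * mergedSum (suc i¹) φᵢ) + ∑ (allFin m) _
        ≈⟨ +-cong head (∑-cong (allFin m) λ j → *-congʳ (weight-suc-skip i¹ (suc (toℕ j)))) ⟩
      (weight (suc i¹) i¹ * mergedSum i¹ φᵢ + weight (suc i¹) (suc i¹) * mergedSum (suc i¹) φᵢ) + ∑ (allFin m) _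
        ≈⟨ mergedSum-suc (suc i¹) φ ⟨
      mergedSum (suc i¹) φ ∎
      where
      φᵢ = φ ∘ (inject₁ i ∷_)
      head : weight i¹ i¹ * mergedSum i¹ φᵢ + weight i¹ (suc i¹) * mergedSum (suc i¹) φᵢ ≈
             weight (suc i¹) i¹ * mergedSum i¹ φᵢ + weight (suc i¹) (suc i¹) * mergedSum (suc i¹) φᵢ
      head = begin
        weight i¹ i¹ * mergedSum i¹ φᵢ + weight i¹ (suc i¹) * mergedSum (suc i¹) φᵢ
          ≈⟨ +-congʳ (*-congˡ (mergedSum-state φᵢ)) ⟩
        weight i¹ i¹ * mergedSum (suc i¹) φᵢ + weight i¹ (suc i¹) * mergedSum (suc i¹) φᵢ
          ≈⟨ distribʳ _ _ _ ⟨
        (weight i¹ i¹ + weight i¹ (suc i¹)) * mergedSum (suc i¹) φᵢ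
          ≈⟨ *-congʳ (weight-merge i¹) ⟩
        weight (suc i¹) (suc i¹) * mergedSum (suc i¹) φᵢ
          -- The step from i + 1 down to i has weight 0 and is added only to match the recursion.
          ≈⟨ 0+-≈ (0*-≈ (weight-> ℕₚ.≤-refl)) ⟨
        weight (suc i¹) i¹ * mergedSum i¹ φᵢ + weight (suc i¹) (suc i¹) * mergedSum (suc i¹) φᵢ ∎

    -- From a state outside the pair, the two letters of the pair have equal continuations by
    -- `mergedSum-state` and weights with sum 0 by `weight-cancel`. Only maps that avoid the pair
    -- survive, and `skip` preserves their weights.
    mergedSum-skip : ∀ {r} x (φ : Vec (Fin (suc (suc m))) r → Carrier) →
                     mergedSum (skip i¹ x) φ ≈ chainSum x (φ ∘ gap)
    mergedSum-skip {zero}  x φ = ≈-refl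
    mergedSum-skip {suc r} x φ = begin
      mergedSum (skip i¹ x) φ
        ≈⟨ mergedSum-suc (skip i¹ x) φ ⟩
      (weight (skip i¹ x) i¹ * mergedSum i¹ φᵢ + weight (skip i¹ x) (suc i¹) * mergedSum (suc i¹) φᵢ) + ∑ (allFin m) _
        ≈⟨ +-cong head (∑-cong (allFin m) λ j → *-cong (weight-skip i¹ x (suc (toℕ j)))
             (mergedSum-skip (suc (toℕ j)) (φ ∘ (skipTwo K i j ∷_)))) ⟩
      0# + ∑ (allFin m) (λ j → weight x (suc (toℕ j)) * chainSum (suc (toℕ j)) (φ ∘ gap ∘ (j ∷_)))
        ≈⟨ +-identityˡ _ ⟩
      ∑ (allFin m) (λ j → weight x (suc (toℕ j)) * chainSum (suc (toℕ j)) (φ ∘ gap ∘ (j ∷_)))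
        ≈⟨ chainSum-suc x (φ ∘ gap) ⟨
      chainSum x (φ ∘ gap) ∎
      where
      φᵢ = φ ∘ (inject₁ i ∷_)
      head : weight (skip i¹ x) i¹ * mergedSum i¹ φᵢ + weight (skip i¹ x) (suc i¹) * mergedSum (suc i¹) φᵢ ≈ 0#
      head = begin
        weight (skip i¹ x) i¹ * mergedSum i¹ φᵢ + weight (skip i¹ x) (suc i¹) * mergedSum (suc i¹) φᵢ
          ≈⟨ +-congʳ (*-congˡ (mergedSum-state φᵢ)) ⟩
        weight (skip i¹ x) i¹ * mergedSum (suc i¹) φᵢ + weight (skip i¹ x) (suc i¹) * mergedSum (suc i¹) φᵢ
          ≈⟨ distribʳ _ _ _ ⟨
        (weight (skip i¹ x) i¹ + weight (skip i¹ x) (suc i¹)) * mergedSum (suc i¹) φᵢ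
          ≈⟨ 0*-≈ (weight-cancel i¹ x) ⟩
        0# ∎

  -- Fibres and signs of maps

  length-filter-tabulate : ∀ {a p n} {A : Set a} {P : A → Set p} (P? : ∀ x → Dec (P x)) (f : Fin n → A) →
    length (filter P? (tabulate f)) ≡ length (filter (P? ∘ f) (allFin n))
  length-filter-tabulate {n = zero}  P? f = refl
  length-filter-tabulate {n = suc n} P? f with P? (f zero)
  ... | yes _ = cong suc (≡.trans (length-filter-tabulate P? (f ∘ suc)) (≡.sym (length-filter-tabulate (P? ∘ f) suc)))
  ... | no  _ = ≡.trans (length-filter-tabulate P? (f ∘ suc)) (≡.sym (length-filter-tabulate (P? ∘ f) suc))

  fiberSize-here : ∀ {r N} x (g : Vec (Fin N) r) → fiberSize K (x ∷ g) x ≡ suc (fiberSize K g x)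
  fiberSize-here x g = ≡.trans
    (cong length (Listₚ.filter-accept (λ k → lookup (x ∷ g) k Finₚ.≟ x) {zero} {tabulate suc} refl))
    (cong suc (length-filter-tabulate (λ k → lookup (x ∷ g) k Finₚ.≟ x) suc))

  fiberSize-there : ∀ {r N x j} (g : Vec (Fin N) r) → x ≢ j → fiberSize K (x ∷ g) j ≡ fiberSize K g j
  fiberSize-there {x = x} {j} g x≢j = ≡.trans
    (cong length (Listₚ.filter-reject (λ k → lookup (x ∷ g) k Finₚ.≟ j) {zero} {tabulate suc} x≢j))
    (length-filter-tabulate (λ k → lookup (x ∷ g) k Finₚ.≟ j) suc)

  fiberSize-∷ : ∀ {r N} x (g : Vec (Fin N) r) j → fiberSize K g j ≤ fiberSize K (x ∷ g) j
  fiberSize-∷ x g j = split (x Finₚ.≟ j)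
    where
    split : Dec (x ≡ j) → fiberSize K g j ≤ fiberSize K (x ∷ g) j
    split (yes refl) = ℕₚ.≤-trans (ℕₚ.n≤1+n _) (ℕₚ.≤-reflexive (≡.sym (fiberSize-here x g)))
    split (no x≢j)   = ℕₚ.≤-reflexive (≡.sym (fiberSize-there g x≢j))

  fiberSize-∉ : ∀ {r N j} (g : Vec (Fin N) r) → (∀ k → lookup g k ≢ j) → fiberSize K g j ≡ 0
  fiberSize-∉ []      p = refl
  fiberSize-∉ (x ∷ g) p = ≡.trans (fiberSize-there g (p zero)) (fiberSize-∉ g (p ∘ suc))

  ∏ : ∀ {n} → (Fin n → Carrier) → Carrier
  ∏ {n} f = Πl K (map f (allFin n))

  ∏-suc : ∀ {n} (f : Fin (suc n) → Carrier) → ∏ f ≡ f zero * ∏ (f ∘ suc)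
  ∏-suc f = cong (λ l → f zero * Πl K l)
    (≡.trans (Listₚ.map-tabulate suc f) (≡.sym (Listₚ.map-tabulate id (f ∘ suc))))

  ∏-cong : ∀ {n} (f g : Fin n → Carrier) → (∀ j → f j ≈ g j) → ∏ f ≈ ∏ g
  ∏-cong {zero}  f g p = ≈-refl
  ∏-cong {suc n} f g p = begin
    ∏ f                    ≡⟨ ∏-suc f ⟩
    f zero * ∏ (f ∘ suc)   ≈⟨ *-cong (p zero) (∏-cong (f ∘ suc) (g ∘ suc) (p ∘ suc)) ⟩
    g zero * ∏ (g ∘ suc)   ≡⟨ ∏-suc g ⟨
    ∏ g                    ∎

  ∏-1 : ∀ {n} (f : Fin n → Carrier) → (∀ j → f j ≈ 1#) → ∏ f ≈ 1#
  ∏-1 {zero}  f p = ≈-refl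
  ∏-1 {suc n} f p = begin
    ∏ f                    ≡⟨ ∏-suc f ⟩
    f zero * ∏ (f ∘ suc)   ≈⟨ *-cong (p zero) (∏-1 (f ∘ suc) (p ∘ suc)) ⟩
    1# * 1#                ≈⟨ *-identityˡ 1# ⟩
    1#                     ∎

  -- Meant for prepending a letter to a map, which changes the fibre of that letter only.
  ∏-scale : ∀ {n} (x : Fin n) s (f g : Fin n → Carrier) → f x ≈ s * g x → (∀ j → j ≢ x → f j ≈ g j) →
            ∏ f ≈ s * ∏ g
  ∏-scale zero s f g p q = begin
    ∏ f                        ≡⟨ ∏-suc f ⟩
    f zero * ∏ (f ∘ suc)       ≈⟨ *-cong p (∏-cong (f ∘ suc) (g ∘ suc) (λ j → q (suc j) λ ())) ⟩
    s * g zero * ∏ (g ∘ suc)   ≈⟨ *-assoc _ _ _ ⟩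
    s * (g zero * ∏ (g ∘ suc)) ≡⟨ cong (s *_) (∏-suc g) ⟨
    s * ∏ g                    ∎
  ∏-scale (suc x) s f g p q = begin
    ∏ f                          ≡⟨ ∏-suc f ⟩
    f zero * ∏ (f ∘ suc)         ≈⟨ *-cong (q zero λ ()) (∏-scale x s (f ∘ suc) (g ∘ suc) p
                                      (λ j j≢x → q (suc j) (j≢x ∘ Finₚ.suc-injective))) ⟩
    g zero * (s * ∏ (g ∘ suc))   ≈⟨ *S.x∙yz≈y∙xz _ _ _ ⟩
    s * (g zero * ∏ (g ∘ suc))   ≡⟨ cong (s *_) (∏-suc g) ⟨
    s * ∏ g                      ∎

  signFactor : ∀ {N} → Fin N → ℕ → Carrier
  signFactor j k = ⟦ ¬? (2 ∣? suc (toℕ j)) ⟧ * neg1^ K k + ⟦ 2 ∣? suc (toℕ j) ⟧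

  signFactor-even : ∀ {N} (j : Fin N) k → Even (suc (toℕ j)) → signFactor j k ≈ 1#
  signFactor-even j k e = ≈-trans (0+-≈ (no-* (¬? (2 ∣? suc (toℕ j))) (λ o → o e))) (⟦⟧-yes (2 ∣? suc (toℕ j)) e)

  signFactor-odd : ∀ {N} (j : Fin N) k → Odd (suc (toℕ j)) → signFactor j k ≈ neg1^ K k
  signFactor-odd j k o = ≈-trans (+0-≈ (⟦⟧-no (2 ∣? suc (toℕ j)) o)) (yes-* (¬? (2 ∣? suc (toℕ j))) o)

  signFactor-0 : ∀ {N} (j : Fin N) → signFactor j 0 ≈ 1#
  signFactor-0 j with 2 ∣? suc (toℕ j)
  ... | yes e = 0+-≈ (zeroˡ _)
  ... | no  o = ≈-trans (+-identityʳ _) (*-identityˡ _)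

  signFactor-suc : ∀ {N} (j : Fin N) k → signFactor j (suc k) ≈ sgn (suc (toℕ j)) * signFactor j k
  signFactor-suc j k = split (2 ∣? suc (toℕ j))
    where
    split : Dec (Even (suc (toℕ j))) → signFactor j (suc k) ≈ sgn (suc (toℕ j)) * signFactor j k
    split (yes e) = begin
      signFactor j (suc k)                  ≈⟨ signFactor-even j (suc k) e ⟩
      1#                                    ≈⟨ *-identityˡ 1# ⟨
      1# * 1#                               ≈⟨ *-cong (sgn-even e) (signFactor-even j k e) ⟨
      sgn (suc (toℕ j)) * signFactor j k    ∎
    split (no o) = begin
      signFactor j (suc k)                  ≈⟨ signFactor-odd j (suc k) o ⟩
      - neg1^ K k                           ≈⟨ -1*x≈-x _ ⟨
      - 1# * neg1^ K k                      ≈⟨ *-cong (sgn-odd o) (signFactor-odd j k o) ⟨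
      sgn (suc (toℕ j)) * signFactor j k    ∎

  signs : ∀ {r N} → Vec (Fin N) r → Carrier
  signs []      = 1#
  signs (y ∷ g) = sgn (suc (toℕ y)) * signs g

  -- Regroups a product over letters into one over positions: each position in the fibre of an odd
  -- letter contributes one factor -1.
  sign≈signs : ∀ {r N} (g : Vec (Fin N) r) → sign K g ≈ signs g
  sign≈signs {N = N} [] = ∏-1 {N} (λ j → signFactor j (fiberSize K [] j)) signFactor-0
  sign≈signs (y ∷ g) = ≈-trans
    (∏-scale y (sgn (suc (toℕ y))) (λ j → signFactor j (fiberSize K (y ∷ g) j)) (λ j → signFactor j (fiberSize K g j))
      (≈-trans (reflexive (cong (signFactor y) (fiberSize-here y g))) (signFactor-suc y (fiberSize K g y)))
      (λ j j≢y → reflexive (cong (signFactor j) (fiberSize-there g (j≢y ∘ ≡.sym)))))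
    (*-congˡ (sign≈signs g))

  -- The coefficient of a map as a chain of weights

  Chained : ∀ {r N} → ℕ → Vec (Fin N) r → Set
  Chained x []      = ⊤
  Chained x (y ∷ g) = (x ⊴ suc (toℕ y)) × Chained (suc (toℕ y)) g

  chained? : ∀ {r N} x (g : Vec (Fin N) r) → Dec (Chained x g)
  chained? x []      = yes tt
  chained? x (y ∷ g) = (x ⊴? suc (toℕ y)) ×-dec chained? (suc (toℕ y)) g

  chain-chained : ∀ {r N} x (g : Vec (Fin N) r) → Chained x g → chain x g ≈ signs g
  chain-chained x []      _       = ≈-refl
  chain-chained x (y ∷ g) (p , q) = *-cong (weight-⊴ p) (chain-chained (suc (toℕ y)) g q)

  chain-¬chained : ∀ {r N} x (g : Vec (Fin N) r) → ¬ Chained x g → chain x g ≈ 0#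
  chain-¬chained x []      ¬p = contradiction tt ¬p
  chain-¬chained x (y ∷ g) ¬p with x ⊴? suc (toℕ y)
  ... | yes p = *0-≈ (chain-¬chained (suc (toℕ y)) g (λ q → ¬p (p , q)))
  ... | no ¬q = 0*-≈ (weight-⋬ ¬q)

  chained-≤ : ∀ {r N x} (g : Vec (Fin N) r) → Chained x g → ∀ k → x ≤ suc (toℕ (lookup g k))
  chained-≤ (y ∷ g) (p , q) zero    = ⊴⇒≤ p
  chained-≤ (y ∷ g) (p , q) (suc k) = ℕₚ.≤-trans (⊴⇒≤ p) (chained-≤ g q k)

  -- A step may stay in place only at an odd letter, so the step after an even one is strict and no
  -- later step goes down. This bounds the even fibres.
  chained-< : ∀ {r N x} (g : Vec (Fin N) r) → Even x → Chained x g → ∀ k → x < suc (toℕ (lookup g k))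
  chained-< (y ∷ g) e (inj₂ (refl , o) , q) k       = contradiction e o
  chained-< (y ∷ g) e (inj₁ p , q)          zero    = p
  chained-< (y ∷ g) e (inj₁ p , q)          (suc k) = ℕₚ.<-≤-trans p (chained-≤ g q k)

  chained⇒increasing : ∀ {r N x} (g : Vec (Fin N) r) → Chained x g → WeaklyIncreasing K g
  chained⇒increasing (y ∷ g) (p , q) zero    zero    k≤l = ℕₚ.≤-refl
  chained⇒increasing (y ∷ g) (p , q) zero    (suc l) k≤l = ℕₚ.≤-pred (chained-≤ g q l)
  chained⇒increasing (y ∷ g) (p , q) (suc k) (suc l) k≤l = chained⇒increasing g q k l (ℕₚ.≤-pred k≤l)

  chained⇒evenFibers : ∀ {r N x} (g : Vec (Fin N) r) → Chained x g → EvenFibers K g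
  chained⇒evenFibers []      _       j e = z≤n
  chained⇒evenFibers (y ∷ g) (p , q) j e = split (y Finₚ.≟ j)
    where
    split : Dec (y ≡ j) → fiberSize K (y ∷ g) j ≤ 1
    split (yes refl) = ℕₚ.≤-reflexive (≡.trans (fiberSize-here y g) (cong suc (fiberSize-∉ g
      (λ k eq → ℕₚ.<-irrefl (cong (suc ∘ toℕ) (≡.sym eq)) (chained-< g e q k)))))
    split (no y≢j)   = ℕₚ.≤-trans (ℕₚ.≤-reflexive (fiberSize-there g y≢j)) (chained⇒evenFibers g q j e)

  -- Equal neighbours put two positions into one fibre, which `EvenFibers` excludes for an even
  -- letter.
  increasing⇒chained : ∀ {r N} y (g : Vec (Fin N) r) →
    WeaklyIncreasing K (y ∷ g) → EvenFibers K (y ∷ g) → Chained (suc (toℕ y)) g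
  increasing⇒chained y []      wi ef = tt
  increasing⇒chained y (z ∷ g) wi ef = step , increasing⇒chained z g
    (λ k l k≤l → wi (suc k) (suc l) (s≤s k≤l))
    (λ j e → ℕₚ.≤-trans (fiberSize-∷ y (z ∷ g) j) (ef j e))
    where
    step : suc (toℕ y) ⊴ suc (toℕ z)
    step with ℕₚ.m≤n⇒m<n∨m≡n (wi zero (suc zero) z≤n)
    ... | inj₁ y<z = inj₁ (s≤s y<z)
    ... | inj₂ y≡z with refl ← Finₚ.toℕ-injective y≡z = inj₂ (refl , λ e → ℕₚ.<⇒≱
      (ℕₚ.≤-trans (s≤s (s≤s z≤n))
        (ℕₚ.≤-reflexive (≡.sym (≡.trans (fiberSize-here y (y ∷ g)) (cong suc (fiberSize-here y g))))))
      (ef y e))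

  evalWeight : ∀ {r N} → Vec (Fin N) r → Carrier
  evalWeight g = ⟦ weaklyIncreasing? K g ⟧ * ⟦ evenFibers? K g ⟧ * sign K g

  -- Equal values of a weakly increasing map are adjacent, so both conditions on g can be tested on
  -- consecutive letters.
  evalWeight≈chain : ∀ {r N} (g : Vec (Fin N) r) → evalWeight g ≈ chain 0 g
  evalWeight≈chain g with chained? 0 g
  ... | yes p = begin
    evalWeight g   ≈⟨ *-congʳ (*-cong (⟦⟧-yes (weaklyIncreasing? K g) (chained⇒increasing g p))
                                      (⟦⟧-yes (evenFibers? K g) (chained⇒evenFibers g p))) ⟩
    1# * 1# * sign K g ≈⟨ *-congʳ (*-identityˡ 1#) ⟩
    1# * sign K g  ≈⟨ *-identityˡ _ ⟩
    sign K g       ≈⟨ sign≈signs g ⟩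
    signs g        ≈⟨ chain-chained 0 g p ⟨
    chain 0 g      ∎
  ... | no ¬p = ≈-trans (0*-≈ indicator) (≈-sym (chain-¬chained 0 g ¬p))
    where
    chained : ∀ {r N} (g : Vec (Fin N) r) → WeaklyIncreasing K g → EvenFibers K g → Chained 0 g
    chained []      wi ef = tt
    -- The initial state 0 lies below every letter, so the first step is always permitted.
    chained (y ∷ g) wi ef = inj₁ (s≤s z≤n) , increasing⇒chained y g wi ef
    indicator : ⟦ weaklyIncreasing? K g ⟧ * ⟦ evenFibers? K g ⟧ ≈ 0#
    indicator with weaklyIncreasing? K g
    ... | no  _  = zeroˡ _
    ... | yes wi = *0-≈ (⟦⟧-no (evenFibers? K g) (λ ef → ¬p (chained g wi ef)))

  δ : ∀ {n} → List (Fin n) → List (Fin n) → Carrier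
  δ w v = ⟦ ≡-dec Finₚ._≟_ w v ⟧

  evalPu≈chainSum : ∀ (pu : PackedWord K) N v → let (r , u , _) = pu in
    evalPu K pu N v ≈ chainSum {r} {N} 0 (λ g → δ (map (lookup g) u) v)
  evalPu≈chainSum (r , u , _) N v = ∑-cong (allMaps K r N) (λ g → *-congʳ (evalWeight≈chain g))

  -- The specialisation property

  Family : Set c
  Family = (n : ℕ) → NCPoly K n

  -- Stated for bare families, so that it applies to evaluations and to linear combinations as well
  -- as to `StablePoly.comp`.
  Cancels : Family → Set ℓ
  Cancels Q = ∀ (m : ℕ) (i : Fin (suc m)) v →
    substVar K (mergeNext K i) (Q (suc (suc m))) v ≈ substVar K (skipTwo K i) (Q m) v

  substVar-cong : ∀ {m n} (f : Fin m → Fin n) {p q : NCPoly K m} → (∀ w → p w ≈ q w) →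
                  ∀ v → substVar K f p v ≈ substVar K f q v
  substVar-cong f p≈q v = ∑-cong (allWords K _ (length v)) (λ w → *-congˡ (p≈q w))

  substVar-0 : ∀ {m n} (f : Fin m → Fin n) v → substVar K f (λ _ → 0#) v ≈ 0#
  substVar-0 f v = ∑-0 (allWords K _ (length v)) (λ w → zeroʳ _)

  substVar-linear : ∀ {m n} (f : Fin m → Fin n) k (p q : NCPoly K m) v →
    substVar K f (λ w → k * p w + q w) v ≈ k * substVar K f p v + substVar K f q v
  substVar-linear f k p q v = begin
    ∑ ws (λ w → δ (map f w) v * (k * p w + q w))
      ≈⟨ ∑-cong ws (λ w → ≈-trans (distribˡ _ _ _) (+-congʳ (*S.x∙yz≈y∙xz _ _ _))) ⟩
    ∑ ws (λ w → k * (δ (map f w) v * p w) + δ (map f w) v * q w)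
      ≈⟨ ∑-+ ws _ _ ⟩
    ∑ ws (λ w → k * (δ (map f w) v * p w)) + ∑ ws (λ w → δ (map f w) v * q w)
      ≈⟨ +-congʳ (∑-*ˡ ws k _) ⟩
    k * substVar K f p v + substVar K f q v ∎
    where ws = allWords K _ (length v)

  cancels-cong : ∀ {P Q : Family} → (∀ n v → P n v ≈ Q n v) → Cancels P → Cancels Q
  cancels-cong {P} {Q} P≈Q cP m i v = begin
    substVar K (mergeNext K i) (Q (suc (suc m))) v ≈⟨ substVar-cong (mergeNext K i) (P≈Q (suc (suc m))) v ⟨
    substVar K (mergeNext K i) (P (suc (suc m))) v ≈⟨ cP m i v ⟩
    substVar K (skipTwo K i) (P m) v               ≈⟨ substVar-cong (skipTwo K i) (P≈Q m) v ⟩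
    substVar K (skipTwo K i) (Q m) v               ∎

  cancels-linear : ∀ k {P Q : Family} → Cancels P → Cancels Q → Cancels (λ n v → k * P n v + Q n v)
  cancels-linear k {P} {Q} cP cQ m i v = begin
    substVar K (mergeNext K i) (λ w → k * P (suc (suc m)) w + Q (suc (suc m)) w) v
      ≈⟨ substVar-linear (mergeNext K i) k (P (suc (suc m))) (Q (suc (suc m))) v ⟩
    k * substVar K (mergeNext K i) (P (suc (suc m))) v + substVar K (mergeNext K i) (Q (suc (suc m))) v
      ≈⟨ +-cong (*-congˡ (cP m i v)) (cQ m i v) ⟩
    k * substVar K (skipTwo K i) (P m) v + substVar K (skipTwo K i) (Q m) v
      ≈⟨ substVar-linear (skipTwo K i) k (P m) (Q m) v ⟨
    substVar K (skipTwo K i) (λ w → k * P m w + Q m w) v ∎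

  -- After exchanging the sums over words and maps, each map g meets only the word
  -- `map (lookup g) u`. Substitution thus composes g with f in the test function and leaves the
  -- chain weight of g alone.
  substVar-evalPu : ∀ {m n} (f : Fin m → Fin n) (pu : PackedWord K) v → let (r , u , _) = pu in
    substVar K f (evalPu K pu m) v ≈ chainSum {r} 0 (λ g → δ (map (lookup (Vec.map f g)) u) v)
  substVar-evalPu {m} f pu@(r , u , _) v = begin
    ∑ ws (λ w → δ (map f w) v * evalPu K pu m w)
      ≈⟨ ∑-cong ws (λ w → *-congˡ (evalPu≈chainSum pu m w)) ⟩
    ∑ ws (λ w → δ (map f w) v * ∑ gs (λ g → chain 0 g * δ (map (lookup g) u) w))
      ≈⟨ ∑-cong ws (λ w → ∑-*ˡ gs _ _) ⟨
    ∑ ws (λ w → ∑ gs (λ g → δ (map f w) v * (chain 0 g * δ (map (lookup g) u) w)))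
      ≈⟨ ∑-swap ws gs _ ⟩
    ∑ gs (λ g → ∑ ws (λ w → δ (map f w) v * (chain 0 g * δ (map (lookup g) u) w)))
      ≈⟨ ∑-cong gs (λ g → ∑-cong ws (λ w → *S.x∙yz≈y∙xz _ _ _)) ⟩
    ∑ gs (λ g → ∑ ws (λ w → chain 0 g * (δ (map f w) v * δ (map (lookup g) u) w)))
      ≈⟨ ∑-cong gs (λ g → ∑-*ˡ ws _ _) ⟩
    ∑ gs (λ g → chain 0 g * ∑ ws (λ w → δ (map f w) v * δ (map (lookup g) u) w))
      ≈⟨ ∑-cong gs (λ g → *-congˡ (inner g)) ⟩
    ∑ gs (λ g → chain 0 g * δ (map (lookup (Vec.map f g)) u) v) ∎
    where
    ws = allWords K m (length v)
    gs = allMaps K r m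
    inner : ∀ g → ∑ ws (λ w → δ (map f w) v * δ (map (lookup g) u) w) ≈ δ (map (lookup (Vec.map f g)) u) v
    inner g with ≡-dec Finₚ._≟_ (map (lookup (Vec.map f g)) u) v
    ... | yes refl = begin
      ∑ ws′ (λ w → δ (map f w) fgu * δ gu w)
        ≈⟨ ∑-allWords-single gu _ (≡.trans (Listₚ.length-map (lookup g) u) (≡.sym (Listₚ.length-map (lookup (Vec.map f g)) u)))
             (λ w w≢ → *-no (≡-dec Finₚ._≟_ gu w) (w≢ ∘ ≡.sym)) ⟩
      δ (map f gu) fgu * δ gu gu
        ≈⟨ yes-* (≡-dec Finₚ._≟_ (map f gu) fgu) (≡.sym fgu≡) ⟩
      δ gu gu
        ≈⟨ ⟦⟧-yes (≡-dec Finₚ._≟_ gu gu) refl ⟩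
      1# ∎
      where
      gu = map (lookup g) u
      fgu = map (lookup (Vec.map f g)) u
      ws′ = allWords K m (length fgu)
      fgu≡ : fgu ≡ map f gu
      fgu≡ = ≡.trans (Listₚ.map-cong (λ k → Vecₚ.lookup-map k f g) u) (Listₚ.map-∘ u)
    ... | no fgu≢v = ∑-0 ws λ w → zero-term w (≡-dec Finₚ._≟_ (map (lookup g) u) w)
      where
      zero-term : ∀ w → Dec (map (lookup g) u ≡ w) → δ (map f w) v * δ (map (lookup g) u) w ≈ 0#
      zero-term w (no ≢)    = *-no (≡-dec Finₚ._≟_ (map (lookup g) u) w) ≢
      zero-term w (yes refl) = no-* (≡-dec Finₚ._≟_ (map f w) v) (λ eq → fgu≢v
        (≡.trans (Listₚ.map-cong (λ k → Vecₚ.lookup-map k f g) u) (≡.trans (Listₚ.map-∘ u) eq)))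

  evalPu-cancels : ∀ pu → Cancels (evalPu K pu)
  evalPu-cancels pu@(r , u , _) m i v = begin
    substVar K (mergeNext K i) (evalPu K pu (suc (suc m))) v
      ≈⟨ substVar-evalPu (mergeNext K i) pu v ⟩
    mergedSum i 0 φ
      -- The initial state 0 lies below the pair, hence has the form required by `mergedSum-skip`.
      ≡⟨ cong (λ x → mergedSum i x φ) (skip-< {suc (toℕ i)} {0} (s≤s z≤n)) ⟨
    mergedSum i (skip (suc (toℕ i)) 0) φ
      ≈⟨ mergedSum-skip i 0 φ ⟩
    chainSum 0 (φ ∘ Vec.map (skipTwo K i))
      ≈⟨ substVar-evalPu (skipTwo K i) pu v ⟨
    substVar K (skipTwo K i) (evalPu K pu m) v ∎
    where
    φ : Vec (Fin (suc (suc m))) r → Carrier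
    φ g = δ (map (lookup g) u) v

  evalWQSym-cancels : ∀ F → Cancels (evalWQSym K F)
  evalWQSym-cancels []             m i v = ≈-trans (substVar-0 (mergeNext K i) v) (≈-sym (substVar-0 (skipTwo K i) v))
  evalWQSym-cancels ((k , pu) ∷ F) = cancels-linear k (evalPu-cancels pu) (evalWQSym-cancels F)

  -- A word that avoids both letters of the pair is its only preimage under merging, and `skipTwo`
  -- is injective, so each side of the specialisation reduces to one coefficient.
  cancels-gap : ∀ {Q} → Cancels Q → ∀ {m} (i : Fin (suc m)) v →
                Q (suc (suc m)) (map (skipTwo K i) v) ≈ Q m v
  cancels-gap {Q} cQ {m} i v = begin
    Q (suc (suc m)) v′
      ≈⟨ yes-* (≡-dec Finₚ._≟_ (map (mergeNext K i) v′) v′) merge-v′ ⟨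
    δ (map (mergeNext K i) v′) v′ * Q (suc (suc m)) v′
      ≈⟨ ∑-allWords-single v′ _ refl (λ w w≢ → no-* (≡-dec Finₚ._≟_ (map (mergeNext K i) w) v′) (w≢ ∘ unmerge w v)) ⟨
    substVar K (mergeNext K i) (Q (suc (suc m))) v′
      ≈⟨ cQ m i v′ ⟩
    substVar K (skipTwo K i) (Q m) v′
      ≈⟨ ∑-allWords-single v _ (≡.sym (Listₚ.length-map (skipTwo K i) v))
           (λ w w≢ → no-* (≡-dec Finₚ._≟_ (map (skipTwo K i) w) v′) (w≢ ∘ Listₚ.map-injective (skipTwo-injective i))) ⟩
    δ v′ v′ * Q m v
      ≈⟨ yes-* (≡-dec Finₚ._≟_ v′ v′) refl ⟩
    Q m v ∎
    where
    v′ = map (skipTwo K i) v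
    merge-v′ : map (mergeNext K i) v′ ≡ v′
    merge-v′ = ≡.trans (≡.sym (Listₚ.map-∘ v)) (Listₚ.map-cong (mergeNext-skipTwo i) v)
    unmerge : ∀ w v → map (mergeNext K i) w ≡ map (skipTwo K i) v → w ≡ map (skipTwo K i) v
    unmerge []      []      _  = refl
    unmerge (x ∷ w) (y ∷ v) eq = cong₂ _∷_
      (mergeNext-skipTwo⁻ i x y (Listₚ.∷-injectiveˡ eq)) (unmerge w v (Listₚ.∷-injectiveʳ eq))

  -- Reduction to words in even letters

  EvenLetter : ∀ {n} → Fin n → Set
  EvenLetter x = Even (suc (toℕ x))

  evenLetter? : ∀ {n} (x : Fin n) → Dec (EvenLetter x)
  evenLetter? x = 2 ∣? suc (toℕ x)

  oddCount : ∀ {n} → List (Fin n) → ℕ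
  oddCount v = length (filter (¬? ∘ evenLetter?) v)

  oddCount-odd : ∀ {n} {x : Fin n} v → ¬ EvenLetter x → oddCount (x ∷ v) ≡ suc (oddCount v)
  oddCount-odd {x = x} v o = cong length (Listₚ.filter-accept (¬? ∘ evenLetter?) {x} {v} o)

  oddCount-even : ∀ {n} {x : Fin n} v → EvenLetter x → oddCount (x ∷ v) ≡ oddCount v
  oddCount-even {x = x} v e = cong length (Listₚ.filter-reject (¬? ∘ evenLetter?) {x} {v} (λ o → o e))

  skipTwo-even : ∀ {m} (i : Fin (suc m)) x → EvenLetter x → EvenLetter (skipTwo K i x)
  skipTwo-even i x e = subst Even
    (≡.trans (skip-suc (toℕ i) (toℕ x)) (cong suc (≡.sym (toℕ-skipTwo i x)))) (skip-even (suc (toℕ i)) e)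

  skipTwo-even⁻ : ∀ {m} (i : Fin (suc m)) x → EvenLetter (skipTwo K i x) → EvenLetter x
  skipTwo-even⁻ i x e = skip-even⁻ (suc (toℕ i)) (subst Even
    (≡.trans (cong suc (toℕ-skipTwo i x)) (≡.sym (skip-suc (toℕ i) (toℕ x)))) e)

  oddCount-skipTwo : ∀ {m} (i : Fin (suc m)) v → oddCount (map (skipTwo K i) v) ≡ oddCount v
  oddCount-skipTwo i []      = refl
  oddCount-skipTwo i (x ∷ v) = split (evenLetter? x)
    where
    split : Dec (EvenLetter x) → oddCount (map (skipTwo K i) (x ∷ v)) ≡ oddCount (x ∷ v)
    split (yes e) = ≡.trans (oddCount-even _ (skipTwo-even i x e))
                   (≡.trans (oddCount-skipTwo i v) (≡.sym (oddCount-even v e)))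
    split (no o)  = ≡.trans (oddCount-odd _ (o ∘ skipTwo-even⁻ i x))
                   (≡.trans (cong suc (oddCount-skipTwo i v)) (≡.sym (oddCount-odd v o)))

  -- Every letter that merging changes is even and becomes odd.
  oddCount-merge : ∀ {m} (i : Fin (suc m)) → ¬ EvenLetter (inject₁ i) → ∀ w →
    (map (mergeNext K i) w ≡ w) ⊎ (oddCount w < oddCount (map (mergeNext K i) w))
  oddCount-merge i o []      = inj₁ refl
  oddCount-merge i o (x ∷ w) = split (x Finₚ.≟ suc i) (oddCount-merge i o w)
    where
    w′ = map (mergeNext K i) w
    weaken : (w′ ≡ w) ⊎ (oddCount w < oddCount w′) → oddCount w ≤ oddCount w′
    weaken (inj₁ eq) = ℕₚ.≤-reflexive (cong oddCount (≡.sym eq))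
    weaken (inj₂ lt) = ℕₚ.<⇒≤ lt
    suc-even : EvenLetter (Fin.suc i)
    suc-even = odd⇒even-suc (subst (λ y → Odd (suc y)) (Finₚ.toℕ-inject₁ i) o)
    grow : Dec (EvenLetter x) → oddCount w < oddCount w′ → oddCount (x ∷ w) < oddCount (x ∷ w′)
    grow (yes e) = ≡.subst₂ _<_ (≡.sym (oddCount-even w e)) (≡.sym (oddCount-even w′ e))
    grow (no o)  = ≡.subst₂ _<_ (≡.sym (oddCount-odd w o)) (≡.sym (oddCount-odd w′ o)) ∘ s≤s
    split : Dec (x ≡ suc i) → (w′ ≡ w) ⊎ (oddCount w < oddCount w′) →
      (mergeNext K i x ∷ w′ ≡ x ∷ w) ⊎ (oddCount (x ∷ w) < oddCount (mergeNext K i x ∷ w′))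
    split (yes refl) ih = inj₂ (≡.subst₂ _<_ (≡.sym (oddCount-even w suc-even))
      (≡.sym (≡.trans (cong (λ y → oddCount (y ∷ w′)) (mergeNext-suc i)) (oddCount-odd w′ o)))
      (s≤s (weaken ih)))
    split (no x≢) (inj₁ eq) = inj₁ (cong₂ _∷_ (mergeNext-≢ i x x≢) eq)
    split (no x≢) (inj₂ lt) = inj₂ (subst (λ y → oddCount (x ∷ w) < oddCount (y ∷ w′))
      (≡.sym (mergeNext-≢ i x x≢)) (grow (evenLetter? x) lt))

  -- Induction on the number of odd letters, bounded by b; n varies because each gap enlarges the
  -- alphabet by two.
  cancels-vanishes : ∀ {Q} → Cancels Q → (∀ n v → All EvenLetter v → Q n v ≈ 0#) → ∀ n v → Q n v ≈ 0#
  cancels-vanishes {Q} cQ base n v = go (suc (oddCount v)) n v ℕₚ.≤-refl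
    where
    go : ∀ b n v → oddCount v < b → Q n v ≈ 0#
    go (suc b) n v lt with All.all? evenLetter? v
    ... | yes evens = base n v evens
    ... | no ¬evens = reduce (find (Allₚ.¬All⇒Any¬ evenLetter? v ¬evens))
      where
      reduce : (∃ λ l → l ∈ v × ¬ EvenLetter l) → Q n v ≈ 0#
      reduce (l , l∈v , o) = begin
        Q n v
          ≈⟨ cancels-gap cQ (suc l) v ⟨
        Q (suc (suc n)) v′
          ≈⟨ yes-* (≡-dec Finₚ._≟_ (map (mergeNext K i) v′) v′) merge-v′ ⟨
        δ (map (mergeNext K i) v′) v′ * Q (suc (suc n)) v′
          -- Any other word that merges to v′ has fewer odd letters and drops out by induction.
          ≈⟨ ∑-allWords-single v′ _ refl others ⟨
        substVar K (mergeNext K i) (Q (suc (suc n))) v′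
          ≈⟨ cQ n i v′ ⟩
        substVar K (skipTwo K i) (Q n) v′
          -- The letter l occurs in v′ but is not a value of `skipTwo K i`.
          ≈⟨ ∑-0 (allWords K n (length v′)) (λ w → no-* (≡-dec Finₚ._≟_ (map (skipTwo K i) w) v′) (missing w)) ⟩
        0# ∎
        where
        i = inject₁ l
        v′ = map (skipTwo K (suc l)) v
        l′∈v′ : inject₁ i ∈ v′
        l′∈v′ = subst (_∈ v′) (Finₚ.toℕ-injective (≡.trans (toℕ-skipTwo (suc l) l)
          (≡.trans (skip-< ℕₚ.≤-refl) (≡.sym (≡.trans (Finₚ.toℕ-inject₁ i) (Finₚ.toℕ-inject₁ l))))))
          (∈-map⁺ (skipTwo K (suc l)) l∈v)
        missing : ∀ w → map (skipTwo K i) w ≢ v′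
        missing w eq with ∈-map⁻ (skipTwo K i) (subst (inject₁ i ∈_) (≡.sym eq) l′∈v′)
        ... | j , _ , eq′ = skipTwo≢inject₁ i j (≡.sym eq′)
        i-odd : ¬ EvenLetter (inject₁ i)
        i-odd = o ∘ subst (λ y → Even (suc y)) (≡.trans (Finₚ.toℕ-inject₁ i) (Finₚ.toℕ-inject₁ l))
        merge-letter : ∀ x → mergeNext K i (skipTwo K (suc l) x) ≡ skipTwo K (suc l) x
        merge-letter x = mergeNext-≢ i _ (λ eq → skip≢ (suc (toℕ l)) (toℕ x)
          (≡.trans (≡.sym (toℕ-skipTwo (suc l) x)) (≡.trans (cong toℕ eq) (cong suc (Finₚ.toℕ-inject₁ l)))))
        merge-v′ : map (mergeNext K i) v′ ≡ v′
        merge-v′ = ≡.trans (≡.sym (Listₚ.map-∘ v)) (Listₚ.map-cong merge-letter v)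
        others : ∀ w → w ≢ v′ → δ (map (mergeNext K i) w) v′ * Q (suc (suc n)) w ≈ 0#
        others w w≢v′ = split (≡-dec Finₚ._≟_ (map (mergeNext K i) w) v′) (oddCount-merge i i-odd w)
          where
          split : Dec (map (mergeNext K i) w ≡ v′) →
                  (map (mergeNext K i) w ≡ w) ⊎ (oddCount w < oddCount (map (mergeNext K i) w)) →
                  δ (map (mergeNext K i) w) v′ * Q (suc (suc n)) w ≈ 0#
          split (no ≢v′) _          = no-* (≡-dec Finₚ._≟_ (map (mergeNext K i) w) v′) ≢v′
          split (yes eq) (inj₁ ≡w)  = contradiction (≡.trans (≡.sym ≡w) eq) w≢v′
          split (yes eq) (inj₂ lt′) = *0-≈ (go b (suc (suc n)) w (ℕₚ.<-≤-trans lt′ (ℕₚ.≤-trans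
            (ℕₚ.≤-reflexive (≡.trans (cong oddCount eq) (oddCount-skipTwo (suc l) v))) (ℕₚ.≤-pred lt))))

  -- Packing of words

  StrictlyIncreasing : ∀ {r} → (Fin r → ℕ) → Set
  StrictlyIncreasing f = ∀ j k → toℕ j < toℕ k → f j < f k

  strict-≥ : ∀ {r} {f : Fin r → ℕ} → StrictlyIncreasing f → ∀ j → toℕ j ≤ f j
  strict-≥ {f = f} inc j = go (toℕ j) j refl
    where
    go : ∀ n j → toℕ j ≡ n → n ≤ f j
    go zero    j       _    = z≤n
    go (suc n) (suc j) refl = ℕₚ.≤-<-trans (go n (inject₁ j) (Finₚ.toℕ-inject₁ j))
      (inc (inject₁ j) (suc j) (s≤s (ℕₚ.≤-reflexive (Finₚ.toℕ-inject₁ j))))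

  strict-cancel-< : ∀ {r} {f : Fin r → ℕ} → StrictlyIncreasing f → ∀ {j k} → f j < f k → toℕ j < toℕ k
  strict-cancel-< {f = f} inc {j} {k} lt = ℕₚ.≰⇒> λ k≤j → ℕₚ.<⇒≱ lt (weak (ℕₚ.m≤n⇒m<n∨m≡n k≤j))
    where
    weak : toℕ k < toℕ j ⊎ toℕ k ≡ toℕ j → f k ≤ f j
    weak (inj₁ k<j) = ℕₚ.<⇒≤ (inc k j k<j)
    weak (inj₂ k≡j) = ℕₚ.≤-reflexive (cong f (Finₚ.toℕ-injective k≡j))

  strict-injective : ∀ {r} {f : Fin r → ℕ} → StrictlyIncreasing f → ∀ {j k} → f j ≡ f k → j ≡ k
  strict-injective inc {j} {k} eq = Finₚ.toℕ-injective (ℕₚ.≤-antisym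
    (ℕₚ.≮⇒≥ λ k<j → ℕₚ.<⇒≢ (inc k j k<j) (≡.sym eq))
    (ℕₚ.≮⇒≥ λ j<k → ℕₚ.<⇒≢ (inc j k j<k) eq))

  Packed : ∀ {r} → List (Fin r) → Set
  Packed {r} u = ∀ (j : Fin r) → j ∈ u

  packed? : ∀ {r} (u : List (Fin r)) → Dec (Packed u)
  packed? u = Finₚ.all? (λ j → DecMembership._∈?_ Finₚ._≟_ j u)

  -- Sending each letter to a position where it occurs is injective. This makes the degree bound
  -- limit the alphabet too.
  packed-length : ∀ {r} {u : List (Fin r)} → Packed u → r ≤ length u
  packed-length {u = u} packed = Finₚ.injective⇒≤ {f = λ j → index (packed j)} λ {j} {k} eq →
    ≡.trans (lookup-index (packed j)) (≡.trans (cong (List.lookup u) eq) (≡.sym (lookup-index (packed k))))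

  -- Expresses pack(v) = u, with g listing the letters of v in increasing order.
  record Packing {N} (v : List (Fin N)) {r} (u : List (Fin r)) (g : Vec (Fin N) r) : Set where
    constructor packing
    field
      packed : Packed u
      strict : StrictlyIncreasing (toℕ ∘ lookup g)
      image  : map (lookup g) u ≡ v

    letter-∈ : ∀ k → lookup g k ∈ v
    letter-∈ k = subst (lookup g k ∈_) image (∈-map⁺ (lookup g) (packed k))

    ∈-letter : ∀ {x} → x ∈ v → ∃ λ k → x ≡ lookup g k
    ∈-letter x∈v with ∈-map⁻ (lookup g) (subst (_ ∈_) (≡.sym image) x∈v)
    ... | k , _ , eq = k , eq

    length≡ : length u ≡ length v
    length≡ = ≡.trans (≡.sym (Listₚ.length-map (lookup g) u)) (cong length image)

  -- Both g and g′ enumerate the letters of v in increasing order, so each entry of g has a place in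
  -- g′.
  relabel : ∀ {N} {v : List (Fin N)} {r u g r′ u′ g′} → Packing v {r} u g → Packing v {r′} u′ g′ →
            ∃ λ (σ : Fin r → Fin r′) → (∀ k → lookup g k ≡ lookup g′ (σ k)) × StrictlyIncreasing (toℕ ∘ σ)
  relabel {g = g} p p′ = (λ k → proj₁ (target k)) , (λ k → proj₂ (target k)) ,
    λ j k j<k → strict-cancel-< (Packing.strict p′)
      (≡.subst₂ _<_ (cong toℕ (proj₂ (target j))) (cong toℕ (proj₂ (target k))) (Packing.strict p j k j<k))
    where
    target : ∀ k → ∃ λ k′ → lookup g k ≡ _
    target k = Packing.∈-letter p′ (Packing.letter-∈ p k)

  packing-size : ∀ {N} {v : List (Fin N)} {r u g r′ u′ g′} → Packing v {r} u g → Packing v {r′} u′ g′ → r ≤ r′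
  packing-size p p′ with relabel p p′
  ... | σ , _ , inc = Finₚ.injective⇒≤ {f = σ} (λ eq → strict-injective inc (cong toℕ eq))

  -- The relabellings σ and τ in the two directions increase strictly, so k ≤ σ k ≤ τ (σ k) = k and
  -- σ is the identity.
  packing-unique : ∀ {N} {v : List (Fin N)} {r u u′} {g g′ : Vec (Fin N) r} →
                   Packing v u g → Packing v u′ g′ → (u ≡ u′) × (g ≡ g′)
  packing-unique {v = v} {r} {u} {u′} {g} {g′} p p′ with relabel p p′ | relabel p′ p
  ... | σ , gσ , inc | τ , gτ , inc′ = words , vectors
    where
    τσ : ∀ k → τ (σ k) ≡ k
    τσ k = strict-injective (Packing.strict p) (cong toℕ (≡.sym (≡.trans (gσ k) (gτ (σ k)))))
    σ≡id : ∀ k → σ k ≡ k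
    σ≡id k = Finₚ.toℕ-injective (ℕₚ.≤-antisym
      (ℕₚ.≤-trans (strict-≥ inc′ (σ k)) (ℕₚ.≤-reflexive (cong toℕ (τσ k)))) (strict-≥ inc k))
    vectors : g ≡ g′
    vectors = ≡.trans (≡.sym (Vecₚ.tabulate∘lookup g)) (≡.trans
      (Vecₚ.tabulate-cong (λ k → ≡.trans (gσ k) (cong (lookup g′) (σ≡id k)))) (Vecₚ.tabulate∘lookup g′))
    words : u ≡ u′
    words = Listₚ.map-injective (λ eq → strict-injective (Packing.strict p) (cong toℕ eq))
      (≡.trans (Packing.image p) (≡.trans (≡.sym (Packing.image p′)) (cong (λ h → map (lookup h) u′) (≡.sym vectors))))

  allPairs-lookup : ∀ {a p} {A : Set a} {R : A → A → Set p} {xs} → AllPairs R xs →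
                    ∀ j k → toℕ j < toℕ k → R (List.lookup xs j) (List.lookup xs k)
  allPairs-lookup (px ∷ pxs) zero    (suc k) _   = All.lookup px (∈-lookup k)
  allPairs-lookup (px ∷ pxs) (suc j) (suc k) j<k = allPairs-lookup pxs j k (ℕₚ.≤-pred j<k)

  map-preimage : ∀ {a b} {A : Set a} {B : Set b} (f : A → B) {v} →
                 (∀ {x} → x ∈ v → ∃ λ a → x ≡ f a) → ∃ λ u → map f u ≡ v
  map-preimage f {[]}    p = [] , refl
  map-preimage f {x ∷ v} p with p (here refl) | map-preimage f (p ∘ there)
  ... | a , refl | u , refl = a ∷ u , refl

  pack : ∀ {N} (v : List (Fin N)) → Σ ℕ λ r → Σ (List (Fin r)) λ u → Σ (Vec (Fin N) r) λ g → Packing v u g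
  pack {N} v = length letters , u , g , packing packed strict image
    where
    ∈v? : ∀ x → Dec (x ∈ v)
    ∈v? x = DecMembership._∈?_ Finₚ._≟_ x v
    letters : List (Fin N)
    letters = filter ∈v? (allFin N)
    g : Vec (Fin N) (length letters)
    g = Vec.tabulate (List.lookup letters)
    lookup-g : ∀ k → lookup g k ≡ List.lookup letters k
    lookup-g = Vecₚ.lookup∘tabulate (List.lookup letters)
    preimage : ∃ λ u → map (lookup g) u ≡ v
    preimage = map-preimage (lookup g) λ x∈v → let x∈letters = ∈-filter⁺ ∈v? (∈-allFin _) x∈v in
      index x∈letters , ≡.trans (lookup-index x∈letters) (≡.sym (lookup-g (index x∈letters)))
    u = proj₁ preimage
    image = proj₂ preimage
    strict : StrictlyIncreasing (toℕ ∘ lookup g)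
    strict j k j<k = ≡.subst₂ _<_ (cong toℕ (≡.sym (lookup-g j))) (cong toℕ (≡.sym (lookup-g k)))
      (allPairs-lookup {xs = letters} (AllPairsₚ.filter⁺ ∈v? (AllPairsₚ.tabulate⁺-< {R = Fin._<_} {f = id} id)) j k j<k)
    packed : Packed u
    packed j with ∈-map⁻ (lookup g) (subst (lookup g j ∈_) (≡.sym image)
                   (subst (_∈ v) (≡.sym (lookup-g j)) (proj₂ (∈-filter⁻ ∈v? {xs = allFin N} (∈-lookup {xs = letters} j)))))
    ... | k , k∈u , eq = subst (_∈ u) (≡.sym (strict-injective strict (cong toℕ eq))) k∈u

  -- Evaluations on words in even letters

  chained⇒strict : ∀ {r N x} (g : Vec (Fin N) r) → (∀ k → EvenLetter (lookup g k)) →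
                   Chained x g → StrictlyIncreasing (toℕ ∘ lookup g)
  chained⇒strict (y ∷ g) evens (p , q) zero    (suc k) _   = ℕₚ.≤-pred (chained-< g (evens zero) q k)
  chained⇒strict (y ∷ g) evens (p , q) (suc j) (suc k) j<k = chained⇒strict g (evens ∘ suc) q j k (ℕₚ.≤-pred j<k)

  strict⇒chained : ∀ {r N x} (g : Vec (Fin N) r) → (∀ k → x < suc (toℕ (lookup g k))) →
                   StrictlyIncreasing (toℕ ∘ lookup g) → Chained x g
  strict⇒chained []      x<  inc = tt
  strict⇒chained (y ∷ g) x<  inc = inj₁ (x< zero) , strict⇒chained g
    (λ k → s≤s (inc zero (suc k) (s≤s z≤n))) (λ j k j<k → inc (suc j) (suc k) (s≤s j<k))

  signs-even : ∀ {r N} (g : Vec (Fin N) r) → (∀ k → EvenLetter (lookup g k)) → signs g ≈ 1#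
  signs-even []      evens = ≈-refl
  signs-even (y ∷ g) evens = ≈-trans (*-cong (sgn-even (evens zero)) (signs-even g (evens ∘ suc))) (*-identityˡ 1#)

  -- On words in even letters P_u(𝔸) is just P_u: only strictly increasing maps contribute.
  chain-δ-0 : ∀ {r N} {u : List (Fin r)} {v : List (Fin N)} (g : Vec (Fin N) r) → Packed u → All EvenLetter v →
              ¬ Packing v u g → chain 0 g * δ (map (lookup g) u) v ≈ 0#
  chain-δ-0 {u = u} {v} g packed evens ¬p = split (≡-dec Finₚ._≟_ (map (lookup g) u) v) (chained? 0 g)
    where
    split : Dec (map (lookup g) u ≡ v) → Dec (Chained 0 g) → chain 0 g * δ (map (lookup g) u) v ≈ 0#
    split (no ≢v)    _       = *-no (≡-dec Finₚ._≟_ (map (lookup g) u) v) ≢v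
    split (yes _)    (no ¬q) = 0*-≈ (chain-¬chained 0 g ¬q)
    split (yes refl) (yes q) = contradiction (packing packed
      (chained⇒strict g (λ k → All.lookup evens (∈-map⁺ (lookup g) (packed k))) q) refl) ¬p

  evalPu-0 : ∀ {r N} {u : List (Fin r)} (packed : Packed u) {v : List (Fin N)} → All EvenLetter v →
             (∀ g → ¬ Packing v u g) → evalPu K (r , u , packed) N v ≈ 0#
  evalPu-0 {r} {N} packed {v} evens ¬p = ≈-trans (evalPu≈chainSum (r , _ , packed) N v)
    (∑-0 (allMaps K r N) (λ g → chain-δ-0 g packed evens (¬p g)))

  -- By uniqueness of packings g is the only contributing map, and its values are even, so its sign
  -- is 1.
  evalPu-1 : ∀ {r N} {u : List (Fin r)} (packed : Packed u) {v : List (Fin N)} {g} → All EvenLetter v →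
             Packing v u g → evalPu K (r , u , packed) N v ≈ 1#
  evalPu-1 {r} {N} {u} packed {v} {g} evens p = begin
    evalPu K (r , u , packed) N v
      ≈⟨ evalPu≈chainSum (r , u , packed) N v ⟩
    chainSum 0 (λ g → δ (map (lookup g) u) v)
      ≈⟨ ∑-allMaps-single g _ (λ g′ g′≢g → chain-δ-0 g′ packed evens (λ p′ → g′≢g (proj₂ (packing-unique p′ p)))) ⟩
    chain 0 g * δ (map (lookup g) u) v
      ≈⟨ *-yes (≡-dec Finₚ._≟_ (map (lookup g) u) v) (Packing.image p) ⟩
    chain 0 g
      ≈⟨ chain-chained 0 g (strict⇒chained g (λ k → s≤s z≤n) (Packing.strict p)) ⟩
    signs g
      ≈⟨ signs-even g (λ k → All.lookup evens (Packing.letter-∈ p k)) ⟩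
    1# ∎

  evalWQSym-++ : ∀ F G N v → evalWQSym K (F ++ G) N v ≈ evalWQSym K F N v + evalWQSym K G N v
  evalWQSym-++ []      G N v = ≈-sym (+-identityˡ _)
  evalWQSym-++ (_ ∷ F) G N v = ≈-trans (+-congˡ (evalWQSym-++ F G N v)) (≈-sym (+-assoc _ _ _))

  evalWQSym-concatMap : ∀ {a} {A : Set a} (h : A → WQSymElt K) xs N v →
    evalWQSym K (concatMap h xs) N v ≈ ∑ xs (λ x → evalWQSym K (h x) N v)
  evalWQSym-concatMap h []       N v = ≈-refl
  evalWQSym-concatMap h (x ∷ xs) N v =
    ≈-trans (evalWQSym-++ (h x) (concatMap h xs) N v) (+-congˡ (evalWQSym-concatMap h xs N v))

  toWord : ∀ {n w} → All (_< n) w → ∃ λ (v : List (Fin n)) → map toℕ v ≡ w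
  toWord []         = [] , refl
  toWord (x<n ∷ ps) with toWord ps
  ... | v , eq = fromℕ< x<n ∷ v , cong₂ _∷_ (Finₚ.toℕ-fromℕ< x<n) eq

  all-≤-sum : ∀ w → All (_≤ sum w) w
  all-≤-sum []      = []
  all-≤-sum (x ∷ w) = ℕₚ.m≤m+n x (sum w) ∷ All.map (λ p → ℕₚ.≤-trans p (ℕₚ.m≤n+m (sum w) x)) (all-≤-sum w)

  -- Coefficients of a stable polynomial and the candidate preimage

  module _ (P : StablePoly K) where
    open StablePoly P

    comp-extend : ∀ k {n} (v : List (Fin n)) (v′ : List (Fin (k ℕ.+ n))) →
                  map toℕ v ≡ map toℕ v′ → comp n v ≈ comp (k ℕ.+ n) v′
    comp-extend zero    v v′ eq = reflexive (cong (comp _) (map-toℕ-injective eq))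
    comp-extend (suc k) {n} v v′ eq with toWord {k ℕ.+ n} {map toℕ v}
      (Allₚ.map⁺ (All.universal (λ x → ℕₚ.<-≤-trans (Finₚ.toℕ<n x) (ℕₚ.m≤n+m n k)) v))
    ... | v₁ , eq₁ = begin
      comp n v                                ≈⟨ comp-extend k v v₁ (≡.sym eq₁) ⟩
      comp (k ℕ.+ n) v₁                       ≈⟨ stable (k ℕ.+ n) v₁ ⟨
      comp (suc (k ℕ.+ n)) (map inject₁ v₁)   ≡⟨ cong (comp _) (map-toℕ-injective (≡.trans
                                                   (≡.sym (Listₚ.map-∘ v₁)) (≡.trans (Listₚ.map-cong Finₚ.toℕ-inject₁ v₁)
                                                   (≡.trans eq₁ eq)))) ⟩
      comp (suc (k ℕ.+ n)) v′                 ∎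

    comp-≤ : ∀ {n n′} → n ≤ n′ → ∀ (v : List (Fin n)) (v′ : List (Fin n′)) →
             map toℕ v ≡ map toℕ v′ → comp n v ≈ comp n′ v′
    comp-≤ {n} {n′} n≤n′ with n′ ℕ.∸ n | ℕₚ.m∸n+n≡m n≤n′
    ... | k | refl = comp-extend k

    comp-coherent : ∀ {n n′} (v : List (Fin n)) (v′ : List (Fin n′)) →
                    map toℕ v ≡ map toℕ v′ → comp n v ≈ comp n′ v′
    comp-coherent {n} {n′} v v′ eq with ℕₚ.≤-total n n′
    ... | inj₁ n≤n′ = comp-≤ n≤n′ v v′ eq
    ... | inj₂ n′≤n = ≈-sym (comp-≤ n′≤n v′ v (≡.sym eq))

    opaque
      -- By stability a coefficient depends on the word alone and not on the number of variables;
      -- `suc (sum w)` is just a number exceeding every letter.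
      coeff : List ℕ → Carrier
      coeff w = comp (suc (sum w)) (proj₁ (toWord (All.map s≤s (all-≤-sum w))))

      comp≈coeff : ∀ {n} (v : List (Fin n)) → comp n v ≈ coeff (map toℕ v)
      comp≈coeff v = comp-coherent v _ (≡.sym (proj₂ (toWord (All.map s≤s (all-≤-sum (map toℕ v))))))

    -- The 0-based letter 2 f(j) + 1 is an even letter in the paper's numbering.
    spread : ∀ {r} → (Fin r → ℕ) → Fin r → ℕ
    spread f j = suc (2 ℕ.* f j)

    -- For packed u this word uses exactly the first r even letters; it represents all words in even
    -- letters whose packing is u.
    packedCoeff : ∀ {r} → List (Fin r) → Carrier
    packedCoeff u = coeff (map (spread toℕ) u)

    term : ∀ {r} (u : List (Fin r)) → Dec (Packed u) → WQSymElt K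
    term {r} u (yes packed) = (packedCoeff u , r , u , packed) ∷ []
    term     u (no _)       = []

    termsOf : ℕ → ℕ → WQSymElt K
    termsOf r k = concatMap (λ u → term u (packed? u)) (allWords K r k)

    -- P vanishes on words longer than d, and a packed word has at most as many distinct letters as
    -- positions, so r and the length need only run up to d. Words that are not packed contribute
    -- the empty combination.
    preimage : WQSymElt K
    preimage = concatMap (λ i → concatMap (λ j → termsOf (toℕ i) (toℕ j)) (allFin (suc d))) (allFin (suc d))
      where d = proj₁ bounded

    -- Coefficients under the specialisation property

    module _ (cP : Cancels comp) where

      coeff-skip : ∀ i w → coeff (map (skip i) w) ≈ coeff w
      coeff-skip i w with toWord {suc (i ℕ.+ sum w)} (All.map (λ p → s≤s (ℕₚ.≤-trans p (ℕₚ.m≤n+m (sum w) i))) (all-≤-sum w))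
      ... | v , eq = begin
        coeff (map (skip i) w)
          ≡⟨ cong coeff letters ⟨
        coeff (map toℕ (map (skipTwo K i′) v))
          ≈⟨ comp≈coeff (map (skipTwo K i′) v) ⟨
        comp (suc (suc n)) (map (skipTwo K i′) v)
          ≈⟨ cancels-gap cP i′ v ⟩
        comp n v
          ≈⟨ comp≈coeff v ⟩
        coeff (map toℕ v)
          ≡⟨ cong coeff eq ⟩
        coeff w ∎
        where
        -- Enough variables for every letter of w and for a gap at i.
        n = suc (i ℕ.+ sum w)
        i<n : i < suc n
        i<n = s≤s (ℕₚ.m≤n⇒m≤1+n (ℕₚ.m≤m+n i (sum w)))
        i′ : Fin (suc n)
        i′ = fromℕ< i<n
        letters : map toℕ (map (skipTwo K i′) v) ≡ map (skip i) w
        letters = ≡.trans (≡.sym (Listₚ.map-∘ v)) (≡.trans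
          (Listₚ.map-cong (λ x → ≡.trans (toℕ-skipTwo i′ x) (cong (λ y → skip y (toℕ x)) (Finₚ.toℕ-fromℕ< i<n))) v)
          (≡.trans (Listₚ.map-∘ v) (cong (map (skip i)) eq)))

      -- Adding 1 to the values from k on adds 2 to the spread letters from `2 ℕ.* k` on, which is
      -- one use of `coeff-skip`.
      coeff-raise : ∀ {r} k (f f′ : Fin r → ℕ) →
        (∀ j → (f′ j < k × f j ≡ f′ j) ⊎ (k ≤ f′ j × f j ≡ suc (f′ j))) →
        ∀ u → coeff (map (spread f) u) ≈ coeff (map (spread f′) u)
      coeff-raise k f f′ rel u = ≈-trans
        (reflexive (cong coeff (≡.trans (Listₚ.map-cong letter u) (Listₚ.map-∘ u))))
        (coeff-skip (2 ℕ.* k) (map (spread f′) u))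
        where
        letter : ∀ j → spread f j ≡ skip (2 ℕ.* k) (spread f′ j)
        letter j with rel j
        ... | inj₁ (lt , eq) = ≡.trans (cong (λ x → suc (2 ℕ.* x)) eq) (≡.sym (skip-<
                (ℕₚ.≤-trans (ℕₚ.≤-reflexive (≡.sym (ℕₚ.*-suc 2 (f′ j)))) (ℕₚ.*-monoʳ-≤ 2 lt))))
        ... | inj₂ (k≤ , eq) = ≡.trans (cong (λ x → suc (2 ℕ.* x)) eq) (≡.trans
                (cong suc (ℕₚ.*-suc 2 (f′ j))) (≡.sym (skip-≥ (ℕₚ.m≤n⇒m≤1+n (ℕₚ.*-monoʳ-≤ 2 k≤)))))

      coeff-shift : ∀ {r} d k (f f′ : Fin r → ℕ) →
        (∀ j → (f′ j < k × f j ≡ f′ j) ⊎ (k ≤ f′ j × f j ≡ d ℕ.+ f′ j)) →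
        ∀ u → coeff (map (spread f) u) ≈ coeff (map (spread f′) u)
      coeff-shift zero k f f′ rel u = reflexive (cong coeff (Listₚ.map-cong (λ j → cong (λ x → suc (2 ℕ.* x)) (same j)) u))
        where
        same : ∀ j → f j ≡ f′ j
        same j with rel j
        ... | inj₁ (_ , eq) = eq
        ... | inj₂ (_ , eq) = eq
      coeff-shift {r} (suc d) k f f′ rel u = ≈-trans
        (coeff-raise k f (λ j → proj₁ (middle j)) (λ j → proj₁ (proj₂ (middle j))) u)
        (coeff-shift d k (λ j → proj₁ (middle j)) f′ (λ j → proj₂ (proj₂ (middle j))) u)
        where
        -- The intermediate function raises the upper values of f′ by d, one less than f does.
        middle : ∀ j → ∃ λ y → ((y < k × f j ≡ y) ⊎ (k ≤ y × f j ≡ suc y)) ×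
                               ((f′ j < k × y ≡ f′ j) ⊎ (k ≤ f′ j × y ≡ d ℕ.+ f′ j))
        middle j with rel j
        ... | inj₁ (lt , eq) = f′ j , inj₁ (lt , eq) , inj₁ (lt , refl)
        ... | inj₂ (k≤ , eq) = d ℕ.+ f′ j , inj₂ (ℕₚ.≤-trans k≤ (ℕₚ.m≤n+m (f′ j) d) , eq) , inj₂ (k≤ , refl)

      -- Closes the gaps of f from left to right; f is already the identity below k.
      coeff-spread : ∀ {r} b k → b ℕ.+ k ≡ r → (f : Fin r → ℕ) → StrictlyIncreasing f →
        (∀ j → toℕ j < k → f j ≡ toℕ j) → ∀ u → coeff (map (spread f) u) ≈ packedCoeff u
      coeff-spread zero k refl f inc f≡ u = reflexive (cong coeff
        (Listₚ.map-cong (λ j → cong (λ x → suc (2 ℕ.* x)) (f≡ j (Finₚ.toℕ<n j))) u))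
      coeff-spread {r} (suc b) k eq f inc f≡ u = ≈-trans
        (coeff-shift d k f f′ rel u)
        (coeff-spread b (suc k) (≡.trans (ℕₚ.+-suc b k) eq) f′ inc′ f′≡ u)
        where
        k<r : k < r
        k<r = ℕₚ.≤-trans (s≤s (ℕₚ.m≤n+m k b)) (ℕₚ.≤-reflexive eq)
        jₖ : Fin r
        jₖ = fromℕ< k<r
        toℕ-jₖ : toℕ jₖ ≡ k
        toℕ-jₖ = Finₚ.toℕ-fromℕ< k<r
        -- The excess of f over the identity at k. Subtracting it from all values from k on makes f
        -- the identity up to k.
        d = f jₖ ℕ.∸ k
        f-jₖ : f jₖ ≡ d ℕ.+ k
        f-jₖ = ≡.sym (ℕₚ.m∸n+n≡m (subst (_≤ f jₖ) toℕ-jₖ (strict-≥ inc jₖ)))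
        f-≥ : ∀ j → k ≤ toℕ j → d ℕ.+ k ≤ f j
        f-≥ j k≤j = subst (_≤ f j) f-jₖ (ℕₚ.≮⇒≥ λ lt →
          ℕₚ.<⇒≱ (subst (toℕ j <_) toℕ-jₖ (strict-cancel-< inc lt)) k≤j)
        lowered : ∀ j → ∃ λ y → (toℕ j < k × f j ≡ y) ⊎ (k ≤ toℕ j × k ≤ y × f j ≡ d ℕ.+ y)
        lowered j with toℕ j ℕₚ.<? k
        ... | yes lt = f j , inj₁ (lt , refl)
        ... | no ≮k = f j ℕ.∸ d , inj₂ (ℕₚ.≮⇒≥ ≮k ,
                ℕₚ.m+n≤o⇒m≤o∸n k (subst (_≤ f j) (ℕₚ.+-comm d k) (f-≥ j (ℕₚ.≮⇒≥ ≮k))) ,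
                ≡.sym (ℕₚ.m+[n∸m]≡n (ℕₚ.≤-trans (ℕₚ.m≤m+n d k) (f-≥ j (ℕₚ.≮⇒≥ ≮k)))))
        f′ : Fin r → ℕ
        f′ j = proj₁ (lowered j)
        rel : ∀ j → (f′ j < k × f j ≡ f′ j) ⊎ (k ≤ f′ j × f j ≡ d ℕ.+ f′ j)
        rel j with lowered j
        ... | y , inj₁ (lt , eq)     = inj₁ (subst (_< k) (≡.trans (≡.sym (f≡ j lt)) eq) lt , eq)
        ... | y , inj₂ (_ , k≤ , eq) = inj₂ (k≤ , eq)
        inc′ : StrictlyIncreasing f′
        inc′ i j i<j with lowered i | lowered j
        ... | _ , inj₁ (_ , eqᵢ)        | _ , inj₁ (_ , eqⱼ)      = ≡.subst₂ _<_ eqᵢ eqⱼ (inc i j i<j)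
        ... | _ , inj₁ (i<k , eqᵢ)      | _ , inj₂ (_ , k≤ , _)   = ℕₚ.<-≤-trans (subst (_< k) (≡.trans (≡.sym (f≡ i i<k)) eqᵢ) i<k) k≤
        ... | _ , inj₂ (k≤i , _ , _)    | _ , inj₁ (j<k , _)      = contradiction (ℕₚ.<-trans i<j j<k) (ℕₚ.≤⇒≯ k≤i)
        ... | _ , inj₂ (_ , _ , eqᵢ)    | _ , inj₂ (_ , _ , eqⱼ)  = ℕₚ.+-cancelˡ-< d _ _ (≡.subst₂ _<_ eqᵢ eqⱼ (inc i j i<j))
        f′≡ : ∀ j → toℕ j < suc k → f′ j ≡ toℕ j
        f′≡ j j≤k with lowered j
        ... | _ , inj₁ (lt , eq)      = ≡.trans (≡.sym eq) (f≡ j lt)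
        ... | y , inj₂ (k≤j , _ , eq) = ≡.trans (ℕₚ.+-cancelˡ-≡ d y k (≡.trans (≡.sym eq)
                (≡.trans (cong f (Finₚ.toℕ-injective (≡.trans toℕj≡k (≡.sym toℕ-jₖ)))) f-jₖ))) (≡.sym toℕj≡k)
          where
          toℕj≡k : toℕ j ≡ k
          toℕj≡k = ℕₚ.≤-antisym (ℕₚ.≤-pred j≤k) k≤j

      -- Halving the even letters writes v as `map (spread f) u` with f strictly increasing, and
      -- `coeff-spread` closes the gaps of f.
      comp≈packedCoeff : ∀ {N r} {v : List (Fin N)} {u : List (Fin r)} {g} → All EvenLetter v →
                         Packing v u g → comp N v ≈ packedCoeff u
      comp≈packedCoeff {N} {r} {v} {u} {g} evens p = begin
        comp N v                 ≈⟨ comp≈coeff v ⟩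
        coeff (map toℕ v)        ≡⟨ cong coeff letters ⟩
        coeff (map (spread f) u) ≈⟨ coeff-spread r 0 (ℕₚ.+-identityʳ r) f inc (λ _ ()) u ⟩
        packedCoeff u            ∎
        where
        half : ∀ j → ∃ λ q → toℕ (lookup g j) ≡ suc (2 ℕ.* q)
        half j with All.lookup evens (Packing.letter-∈ p j)
        -- The quotient is positive because the parity is that of a letter numbered from 1.
        ... | divides (suc q) eq = q , ≡.trans (ℕₚ.suc-injective eq) (cong suc (ℕₚ.*-comm q 2))
        f : Fin r → ℕ
        f j = proj₁ (half j)
        letters : map toℕ v ≡ map (spread f) u
        letters = ≡.trans (cong (map toℕ) (≡.sym (Packing.image p)))
          (≡.trans (≡.sym (Listₚ.map-∘ u)) (Listₚ.map-cong (λ j → proj₂ (half j)) u))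
        inc : StrictlyIncreasing f
        inc j k j<k = ℕₚ.*-cancelˡ-< 2 _ _ (ℕₚ.≤-pred
          (≡.subst₂ _<_ (proj₂ (half j)) (proj₂ (half k)) (Packing.strict p j k j<k)))

      term-0 : ∀ {N r} {v : List (Fin N)} (u : List (Fin r)) → All EvenLetter v →
               (∀ g → ¬ Packing v u g) → evalWQSym K (term u (packed? u)) N v ≈ 0#
      term-0 u evens ¬p with packed? u
      ... | yes packed = ≈-trans (+-identityʳ _) (*0-≈ (evalPu-0 packed evens ¬p))
      ... | no _       = ≈-refl

      term-comp : ∀ {N r} {v : List (Fin N)} (u : List (Fin r)) {g} → All EvenLetter v →
                  Packing v u g → evalWQSym K (term u (packed? u)) N v ≈ comp N v
      term-comp u evens p with packed? u
      ... | yes packed = ≈-trans (+-identityʳ _) (≈-trans (*-congˡ (evalPu-1 packed evens p))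
                           (≈-trans (*-identityʳ _) (≈-sym (comp≈packedCoeff evens p))))
      ... | no ¬packed = contradiction (Packing.packed p) ¬packed

      -- Only the term of the packing of v can survive at v. It is present if v has length at most
      -- d; for longer v both sides are 0.
      comp≈preimage : ∀ N v → All EvenLetter v → comp N v ≈ evalWQSym K preimage N v
      comp≈preimage N v evens = ≈-trans (split (length v ℕₚ.≤? d)) (≈-sym expand)
        where
        d = proj₁ bounded
        t : ∀ {r} → List (Fin r) → Carrier
        t u = evalWQSym K (term u (packed? u)) N v
        inner : ℕ → ℕ → Carrier
        inner r k = ∑ (allWords K r k) t
        expand : evalWQSym K preimage N v ≈ ∑ (allFin (suc d)) (λ i → ∑ (allFin (suc d)) (λ j → inner (toℕ i) (toℕ j)))
        expand = ≈-trans
          (evalWQSym-concatMap (λ i → concatMap (λ j → termsOf (toℕ i) (toℕ j)) (allFin (suc d))) (allFin (suc d)) N v)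
          (∑-cong (allFin (suc d)) λ i → ≈-trans
            (evalWQSym-concatMap (λ j → termsOf (toℕ i) (toℕ j)) (allFin (suc d)) N v)
            (∑-cong (allFin (suc d)) λ j →
              evalWQSym-concatMap (λ u → term u (packed? u)) (allWords K (toℕ i) (toℕ j)) N v))
        only : ∀ {r} (u : List (Fin r)) {g} → Packing v u g →
               ∀ (i j : Fin (suc d)) → toℕ i ≡ r → toℕ j ≡ length u →
               comp N v ≈ ∑ (allFin (suc d)) (λ i → ∑ (allFin (suc d)) (λ j → inner (toℕ i) (toℕ j)))
        only u p i j refl j≡ = begin
          comp N v
            ≈⟨ term-comp u evens p ⟨
          t u
            ≈⟨ ∑-allWords-single u t (≡.sym j≡) (λ u′ u′≢u → term-0 u′ evens (λ g p′ → u′≢u (proj₁ (packing-unique p′ p)))) ⟨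
          inner (toℕ i) (toℕ j)
            ≈⟨ ∑-allFin-single j (λ j′ → inner (toℕ i) (toℕ j′)) (λ j′ j′≢j → ∑-allWords-0 (toℕ i) (toℕ j′) t λ u′ eq →
                 term-0 u′ evens λ g p′ → j′≢j (Finₚ.toℕ-injective (≡.trans (≡.sym eq) (≡.trans (Packing.length≡ p′)
                   (≡.trans (≡.sym (Packing.length≡ p)) (≡.sym j≡)))))) ⟨
          ∑ (allFin (suc d)) (λ j → inner (toℕ i) (toℕ j))
            ≈⟨ ∑-allFin-single i (λ i′ → ∑ (allFin (suc d)) (λ j → inner (toℕ i′) (toℕ j)))
                 (λ i′ i′≢i → ∑-0 (allFin (suc d)) λ j → ∑-0 (allWords K (toℕ i′) (toℕ j)) λ u′ → term-0 u′ evens λ g p′ →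
                   i′≢i (Finₚ.toℕ-injective (ℕₚ.≤-antisym (packing-size p′ p) (packing-size p p′)))) ⟨
          ∑ (allFin (suc d)) (λ i → ∑ (allFin (suc d)) (λ j → inner (toℕ i) (toℕ j))) ∎
        split : Dec (length v ≤ d) → comp N v ≈ ∑ (allFin (suc d)) (λ i → ∑ (allFin (suc d)) (λ j → inner (toℕ i) (toℕ j)))
        split (yes v≤d) with pack v
        ... | r , u , g , p = only u p (fromℕ< (s≤s r≤d)) (fromℕ< (s≤s u≤d)) (Finₚ.toℕ-fromℕ< _) (Finₚ.toℕ-fromℕ< _)
          where
          u≤d : length u ≤ d
          u≤d = subst (_≤ d) (≡.sym (Packing.length≡ p)) v≤d
          r≤d : r ≤ d
          r≤d = ℕₚ.≤-trans (packed-length (Packing.packed p)) u≤d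
        split (no v≰d) = ≈-trans (proj₂ bounded N v (ℕₚ.≰⇒> v≰d)) (≈-sym
          (∑-0 (allFin (suc d)) λ i → ∑-0 (allFin (suc d)) λ j → ∑-allWords-0 (toℕ i) (toℕ j) t λ u eq →
            term-0 u evens λ g p → v≰d (subst (_≤ d) (≡.trans (≡.sym eq) (Packing.length≡ p)) (ℕₚ.≤-pred (Finₚ.toℕ<n j)))))

      -- The difference from the evaluated preimage inherits the specialisation property and
      -- vanishes on words in even letters, hence everywhere.
      cancels⇒InWQSym𝔸 : InWQSym𝔸 K P
      cancels⇒InWQSym𝔸 = preimage , λ N v → begin
        comp N v
          ≈⟨ +-identityˡ _ ⟨
        0# + comp N v
          ≈⟨ +-congʳ (-‿inverseʳ _) ⟨
        (evalWQSym K preimage N v + - evalWQSym K preimage N v) + comp N v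
          ≈⟨ +-assoc _ _ _ ⟩
        evalWQSym K preimage N v + (- evalWQSym K preimage N v + comp N v)
          ≈⟨ +-congˡ (+-congʳ (-1*x≈-x _)) ⟨
        evalWQSym K preimage N v + difference N v
          ≈⟨ +0-≈ (cancels-vanishes (cancels-linear (- 1#) (evalWQSym-cancels preimage) cP) difference-even N v) ⟩
        evalWQSym K preimage N v ∎
        where
        difference : Family
        difference N v = - 1# * evalWQSym K preimage N v + comp N v
        difference-even : ∀ N v → All EvenLetter v → difference N v ≈ 0#
        difference-even N v evens = ≈-trans
          (+-cong (-1*x≈-x _) (comp≈preimage N v evens)) (-‿inverseˡ _)

theorem5p1 : ∀ {c ℓ : Level} (K : CharZeroField c ℓ) (P : StablePoly K) →
    (SpecCondition K P → InWQSym𝔸 K P) × (InWQSym𝔸 K P → SpecCondition K P)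
theorem5p1 K P =
  cancels⇒InWQSym𝔸 K P ,
  λ (F , P≈F) → cancels-cong K (λ n v → CharZeroField.sym K (P≈F n v)) (evalWQSym-cancels K F)
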